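{- There is an absolute constant $C>0$ such that for every positive integer $r$ and every sufficiently large $n$ (depending on $r$), $F_r(n)\le Cn/r$; that is, $F_r(n)=O(n/r)$.
   Context: For a positive integer $n$, $[n]=\{1,\dots,n\}$ and $[n]^{(2)}$ is the set of $2$-element subsets of $[n]$. $\mathcal{C}_{n;r}$ is the set of all maps $c:[n]^{(2)}\to[r]$. For such $c$, a twin of size $\ell$ is a pair of disjoint sets $I=\{i_1<\dots<i_\ell\}$, $J=\{j_1<\dots<j_\ell\}\subset[n]$ with $c(\{i_t,i_{t+1}\})=c(\{j_t,j_{t+1}\})$ for all $t=1,\dots,\ell-1$; $f(c)$ is the maximum size of a twin of $c$, and $F_r(n)=\min_{c\in\mathcal{C}_{n;r}}f(c)$. -}

module Defs where

open import Data.Nat using (ℕ; suc; _≤_; _*_)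
open import Data.Fin using (Fin; toℕ; _<_)
open import Data.Product using (Σ; _×_)
open import Relation.Binary.PropositionalEquality using (_≡_; _≢_)

-- An r-colouring of the edges of the complete graph on [n] (vertices Fin n).
-- c i j is only ever consulted for i < j, so it represents a map [n]^(2) → [r];
-- every map [n]^(2) → [r] arises this way.
Colouring : ℕ → ℕ → Set
Colouring n r = Fin n → Fin n → Fin r

record Twin {n r : ℕ} (c : Colouring n r) (ℓ : ℕ) : Set where
  field
    I J      : Fin ℓ → Fin n
    I-incr   : ∀ s t → s < t → I s < I t
    J-incr   : ∀ s t → s < t → J s < J t
    disjoint : ∀ s t → I s ≢ J t
    colours  : ∀ (s t : Fin ℓ) → toℕ t ≡ suc (toℕ s) → c (I s) (I t) ≡ c (J s) (J t)

-- F_r(n) * r ≤ C * n  (i.e. F_r(n) ≤ C n / r): some colouring c has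
-- every twin of size ℓ satisfying ℓ * r ≤ C * n.
FBound : ℕ → ℕ → ℕ → Set
FBound C r n = Σ (Colouring n r) λ c → ∀ ℓ → Twin c ℓ → ℓ * r ≤ C * n

{-# OPTIONS --safe #-}

-- Cut [n] into blocks of length 2 ^ D ~ r and give an edge inside a block as its level the first
-- binary digit in which its ends differ. The colour of an edge tells whether it is long (between two
-- blocks), medium (level below 64) or short, and for a short edge also the level. Only O(n / r)
-- edges of a path are long or medium. For a short edge i → i′ of level k the colour also contains a
-- letter of a random word attached to k and the block of i, and all digits of i except two fields y
-- and z among those before position k, of which only z + α y is shown. The fields and the slope α
-- depend on k in such a way that the pair of positions of the twin determines k, while steps of
-- level k do not change the fields.
-- Hence, as long as both paths of the twin are in the same block, two short steps in a row would have
-- the same level, which is impossible. In different blocks A and B only levels k at which the letters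
-- of A and B agree can be used, and if there are s of them then at most 2 ^ (64 + s) steps fit in.
-- Long edges show a letter of a second random word over 2 ^ D letters, so the pairs (A , B) that are
-- left again form an increasing chain of matches in this word, and there are only O(2 ^ (- D / 2)) N
-- of these among N blocks. For the pairs with s ≥ D / 2, where more than O(2 ^ (D / 2)) steps are
-- possible, the bound is even O(2 ^ (- D)) N. Both bounds come from a first moment count.

module Submission where

open import Defs
open import Data.Bool using (Bool; true; false)
open import Data.Bool.Properties using () renaming (_≟_ to _≟ᵇ_)
open import Data.Empty using (⊥)
open import Data.Fin as Fin using (Fin; toℕ; fromℕ<)
import Data.Fin.Properties as Fin
open import Data.List using (List; []; _∷_; _++_; map; length; take; drop; replicate; downFrom; cartesianProductWith)
open import Data.List.Properties using (∷-injective; length-++; length-map; length-take; length-drop; length-replicate; take++drop≡id; drop-drop)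
open import Data.Nat
open import Data.Nat.DivMod using (m≡m%n+[m/n]*n; m%n<n; /-monoˡ-≤; m<n*o⇒m/o<n)
open import Data.Nat.Properties
open import Data.Nat.Tactic.RingSolver using (solve-∀)
open import Data.Product using (Σ; ∃; _×_; _,_; proj₁; proj₂)
open import Data.Sum using (_⊎_; inj₁; inj₂)
open import Data.Vec as Vec using (Vec; []; _∷_; toList)
open import Data.Vec.Properties using (≡-dec; length-toList)
open import Relation.Binary.Definitions using (tri<; tri≈; tri>; DecidableEquality)
open import Relation.Binary.PropositionalEquality hiding (J)
open import Relation.Nullary using (¬_; Dec; yes; no; does; contradiction)
open import Relation.Nullary.Decidable using (dec-true)

-- Finite sums and words

private
  variable
    A B : Set

∑ : List A → (A → ℕ) → ℕ
∑ []       f = 0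
∑ (x ∷ xs) f = f x + ∑ xs f

∑-cong : (xs : List A) {f g : A → ℕ} → (∀ x → f x ≡ g x) → ∑ xs f ≡ ∑ xs g
∑-cong []       h = refl
∑-cong (x ∷ xs) h = cong₂ _+_ (h x) (∑-cong xs h)

∑-mono : (xs : List A) {f g : A → ℕ} → (∀ x → f x ≤ g x) → ∑ xs f ≤ ∑ xs g
∑-mono []       h = z≤n
∑-mono (x ∷ xs) h = +-mono-≤ (h x) (∑-mono xs h)

∑-distrib-+ : (xs : List A) (f g : A → ℕ) → ∑ xs (λ x → f x + g x) ≡ ∑ xs f + ∑ xs g
∑-distrib-+ []       f g = refl
∑-distrib-+ (x ∷ xs) f g rewrite ∑-distrib-+ xs f g = lemma (f x) (g x) (∑ xs f) (∑ xs g)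
  where
  lemma : ∀ a b c d → a + b + (c + d) ≡ a + c + (b + d)
  lemma = solve-∀

∑-distribˡ-* : (xs : List A) (c : ℕ) (f : A → ℕ) → ∑ xs (λ x → c * f x) ≡ c * ∑ xs f
∑-distribˡ-* []       c f = sym (*-zeroʳ c)
∑-distribˡ-* (x ∷ xs) c f =
  trans (cong (c * f x +_) (∑-distribˡ-* xs c f)) (sym (*-distribˡ-+ c (f x) (∑ xs f)))

∑-distribʳ-* : (xs : List A) (c : ℕ) (f : A → ℕ) → ∑ xs (λ x → f x * c) ≡ ∑ xs f * c
∑-distribʳ-* xs c f = trans (∑-cong xs (λ x → *-comm (f x) c))
                      (trans (∑-distribˡ-* xs c f) (*-comm c (∑ xs f)))

∑-const : (xs : List A) (c : ℕ) → ∑ xs (λ _ → c) ≡ length xs * c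
∑-const []       c = refl
∑-const (x ∷ xs) c = cong (c +_) (∑-const xs c)

∑-swap : (xs : List A) (ys : List B) (f : A → B → ℕ) →
         ∑ xs (λ x → ∑ ys (f x)) ≡ ∑ ys (λ y → ∑ xs (λ x → f x y))
∑-swap []       ys f = sym (trans (∑-const ys 0) (*-zeroʳ (length ys)))
∑-swap (x ∷ xs) ys f =
  trans (cong (∑ ys (f x) +_) (∑-swap xs ys f)) (sym (∑-distrib-+ ys (f x) _))

∑-++ : (xs ys : List A) (f : A → ℕ) → ∑ (xs ++ ys) f ≡ ∑ xs f + ∑ ys f
∑-++ []       ys f = refl
∑-++ (x ∷ xs) ys f = trans (cong (f x +_) (∑-++ xs ys f)) (sym (+-assoc (f x) _ _))

∑-map : (xs : List A) (h : A → B) (f : B → ℕ) → ∑ (map h xs) f ≡ ∑ xs (λ x → f (h x))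
∑-map []       h f = refl
∑-map (x ∷ xs) h f = cong (f (h x) +_) (∑-map xs h f)

∑-downFrom-cong : ∀ p {f g : ℕ → ℕ} → (∀ {a} → a < p → f a ≡ g a) →
                  ∑ (downFrom p) f ≡ ∑ (downFrom p) g
∑-downFrom-cong zero    h = refl
∑-downFrom-cong (suc p) h = cong₂ _+_ (h ≤-refl) (∑-downFrom-cong p (λ a<p → h (m<n⇒m<1+n a<p)))

∑-downFrom-term : ∀ {p a} → a < p → (f : ℕ → ℕ) → f a ≤ ∑ (downFrom p) f
∑-downFrom-term {suc p} {a} (s≤s a≤p) f with m≤n⇒m<n∨m≡n a≤p
... | inj₁ a<p  = ≤-trans (∑-downFrom-term a<p f) (m≤n+m _ (f p))
... | inj₂ refl = m≤m+n (f a) _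

-- The geometric sum 1 + x + … + x^(p-1) with x = (g+1)/g, cleared of denominators.
∑-geometric : ∀ g K p (φ : ℕ → ℕ) → (∀ {a} → a < p → g ^ a * φ a ≤ K * suc g ^ a) →
              g ^ p * ∑ (downFrom p) φ + K * g * g ^ p ≤ K * g * suc g ^ p
∑-geometric g K zero    φ h = ≤-refl
∑-geometric g K (suc p) φ h = begin
  g * g ^ p * (φ p + ∑ (downFrom p) φ) + K * g * (g * g ^ p)
    ≡⟨ lemma₁ g (g ^ p) (φ p) (∑ (downFrom p) φ) K ⟩
  g * (g ^ p * φ p) + g * (g ^ p * ∑ (downFrom p) φ + K * g * g ^ p)
    ≤⟨ +-mono-≤ (*-monoʳ-≤ g (h ≤-refl))
                (*-monoʳ-≤ g (∑-geometric g K p φ (λ a<p → h (m<n⇒m<1+n a<p)))) ⟩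
  g * (K * suc g ^ p) + g * (K * g * suc g ^ p)
    ≡⟨ lemma₂ g K (suc g ^ p) ⟩
  K * g * (suc g * suc g ^ p) ∎
  where
  open ≤-Reasoning
  lemma₁ : ∀ g P x s K → g * P * (x + s) + K * g * (g * P) ≡ g * (P * x) + g * (P * s + K * g * P)
  lemma₁ = solve-∀
  lemma₂ : ∀ g K S → g * (K * S) + g * (K * g * S) ≡ K * g * (S + g * S)
  lemma₂ = solve-∀

allVec : List A → (n : ℕ) → List (Vec A n)
allVec xs zero    = [] ∷ []
allVec xs (suc n) = cartesianProductWith _∷_ xs (allVec xs n)

∑-allVec : (xs : List A) (n : ℕ) (f : Vec A (suc n) → ℕ) →
           ∑ (allVec xs (suc n)) f ≡ ∑ xs (λ x → ∑ (allVec xs n) (λ v → f (x ∷ v)))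
∑-allVec {A = A} xs n f = go xs
  where
  go : (zs : List A) → ∑ (cartesianProductWith _∷_ zs (allVec xs n)) f ≡
       ∑ zs (λ x → ∑ (allVec xs n) (λ v → f (x ∷ v)))
  go []       = refl
  go (z ∷ zs) = trans (∑-++ (map (z ∷_) (allVec xs n)) _ f)
                      (cong₂ _+_ (∑-map (allVec xs n) (z ∷_) f) (go zs))

length-allVec : (xs : List A) (n : ℕ) → length (allVec xs n) ≡ length xs ^ n
length-allVec xs zero    = refl
length-allVec xs (suc n) = trans (go xs) (cong (length xs *_) (length-allVec xs n))
  where
  go : ∀ zs → length (cartesianProductWith _∷_ zs (allVec xs n)) ≡ length zs * length (allVec xs n)
  go []       = refl
  go (z ∷ zs) = trans (length-++ (map (z ∷_) (allVec xs n)))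
                      (cong₂ _+_ (length-map (z ∷_) (allVec xs n)) (go zs))

-- Letters of a word, with d standing for every letter beyond its end.
at : A → ∀ {N} → Vec A N → ℕ → A
at d []      i       = d
at d (x ∷ w) zero    = x
at d (x ∷ w) (suc i) = at d w i

set : ∀ {N} → Vec A N → ℕ → A → Vec A N
set []      i       y = []
set (x ∷ w) zero    y = y ∷ w
set (x ∷ w) (suc i) y = x ∷ set w i y

at-set-same : ∀ d {N} (w : Vec A N) {i} y → i < N → at d (set w i y) i ≡ y
at-set-same d (x ∷ w) {zero}  y i<N       = refl
at-set-same d (x ∷ w) {suc i} y (s≤s i<N) = at-set-same d w y i<N

at-set-other : ∀ d {N} (w : Vec A N) {i j} y → i ≢ j → at d (set w i y) j ≡ at d w j
at-set-other d []      y i≢j = refl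
at-set-other d (x ∷ w) {zero}  {zero}  y i≢j = contradiction refl i≢j
at-set-other d (x ∷ w) {zero}  {suc j} y i≢j = refl
at-set-other d (x ∷ w) {suc i} {zero}  y i≢j = refl
at-set-other d (x ∷ w) {suc i} {suc j} y i≢j = at-set-other d w y (λ e → i≢j (cong suc e))

-- Overwriting position `c` in all words by all letters yields every word `length xs` times, because
-- the letter that stood there is forgotten.
resample : (xs : List A) {N c : ℕ} → c < N → (F : Vec A N → ℕ) →
           ∑ (allVec xs N) (λ w → ∑ xs (λ x → F (set w c x))) ≡ length xs * ∑ (allVec xs N) F
resample xs {suc N} {zero} c<N F = begin
  ∑ (allVec xs (suc N)) (λ w → ∑ xs (λ x → F (set w 0 x)))
    ≡⟨ ∑-allVec xs N _ ⟩
  ∑ xs (λ _ → ∑ W (λ w → ∑ xs (λ x → F (x ∷ w))))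
    ≡⟨ ∑-const xs _ ⟩
  length xs * ∑ W (λ w → ∑ xs (λ x → F (x ∷ w)))
    ≡⟨ cong (length xs *_) (∑-swap W xs (λ w x → F (x ∷ w))) ⟩
  length xs * ∑ xs (λ x → ∑ W (λ w → F (x ∷ w)))
    ≡⟨ cong (length xs *_) (sym (∑-allVec xs N F)) ⟩
  length xs * ∑ (allVec xs (suc N)) F ∎
  where
  open ≡-Reasoning
  W = allVec xs N
resample xs {suc N} {suc c} (s≤s c<N) F = begin
  ∑ (allVec xs (suc N)) (λ w → ∑ xs (λ x → F (set w (suc c) x)))
    ≡⟨ ∑-allVec xs N _ ⟩
  ∑ xs (λ y → ∑ W (λ w → ∑ xs (λ x → F (y ∷ set w c x))))
    ≡⟨ ∑-cong xs (λ y → resample xs c<N (λ w → F (y ∷ w))) ⟩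
  ∑ xs (λ y → length xs * ∑ W (λ w → F (y ∷ w)))
    ≡⟨ ∑-distribˡ-* xs (length xs) _ ⟩
  length xs * ∑ xs (λ y → ∑ W (λ w → F (y ∷ w)))
    ≡⟨ cong (length xs *_) (sym (∑-allVec xs N F)) ⟩
  length xs * ∑ (allVec xs (suc N)) F ∎
  where
  open ≡-Reasoning
  W = allVec xs N

-- Conditioning on all letters but the one at `c`: an estimate valid for each choice of the other
-- letters survives averaging over all words.
resample-≤ : (xs : List A) .{{_ : NonZero (length xs)}} {N c Q : ℕ} → c < N →
             (F G : Vec A N → ℕ) →
             (∀ w → Q * ∑ xs (λ x → F (set w c x)) ≤ length xs * G w) →
             Q * ∑ (allVec xs N) F ≤ ∑ (allVec xs N) G
resample-≤ xs {N} {c} {Q} c<N F G h = *-cancelˡ-≤ (length xs) (begin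
  length xs * (Q * ∑ W F)          ≡⟨ lemma (length xs) Q (∑ W F) ⟩
  Q * (length xs * ∑ W F)          ≡⟨ cong (Q *_) (sym (resample xs c<N F)) ⟩
  Q * ∑ W (λ w → ∑ xs (λ x → F (set w c x)))
                                   ≡⟨ sym (∑-distribˡ-* W Q _) ⟩
  ∑ W (λ w → Q * ∑ xs (λ x → F (set w c x)))
                                   ≤⟨ ∑-mono W h ⟩
  ∑ W (λ w → length xs * G w)      ≡⟨ ∑-distribˡ-* W (length xs) G ⟩
  length xs * ∑ W G                ∎)
  where
  open ≤-Reasoning
  W = allVec xs N
  lemma : ∀ a b c → a * (b * c) ≡ b * (a * c)
  lemma = solve-∀

𝟙 : Bool → ℕ
𝟙 true  = 1
𝟙 false = 0

-- First moment method: if every value were at least 1, the sum would reach the number of entries.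
∑<length⇒∃0 : (xs : List A) (f : A → ℕ) → ∑ xs f < length xs → ∃ λ x → f x ≡ 0
∑<length⇒∃0 (x ∷ xs) f h with f x in eq
... | zero  = x , eq
... | suc m = ∑<length⇒∃0 xs f (≤-trans (s≤s (m≤n+m _ m)) (≤-pred h))

-- Chains of matches in a word

power-product : ∀ a b n → (a * b) ^ n ≡ a ^ n * b ^ n
power-product a b zero    = refl
power-product a b (suc n) rewrite power-product a b n = lemma a b (a ^ n) (b ^ n)
  where
  lemma : ∀ a b c d → a * b * (c * d) ≡ a * c * (b * d)
  lemma = solve-∀

-- With `j = g + 1 - n` this is Bernoulli's inequality `(1 - 1/(g+1)) ^ n ≥ 1 - n/(g+1)`, cleared of
-- denominators.
bernoulli : ∀ g n j → n + j ≡ suc g → suc g ^ n * j ≤ g ^ n * suc g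
bernoulli g zero    j e rewrite e = ≤-refl
bernoulli g (suc n) j e = begin
  suc g * suc g ^ n * j        ≡⟨ lemma₁ g (suc g ^ n) j ⟩
  suc g ^ n * (j + g * j)      ≤⟨ *-monoʳ-≤ (suc g ^ n) (+-monoˡ-≤ (g * j) j≤g) ⟩
  suc g ^ n * (g + g * j)      ≡⟨ lemma₂ g (suc g ^ n) j ⟩
  g * (suc g ^ n * suc j)      ≤⟨ *-monoʳ-≤ g (bernoulli g n (suc j) (trans (+-suc n j) e)) ⟩
  g * (g ^ n * suc g)          ≡⟨ sym (*-assoc g (g ^ n) (suc g)) ⟩
  g * g ^ n * suc g            ∎
  where
  open ≤-Reasoning
  j≤g : j ≤ g
  j≤g = ≤-trans (m≤n+m j n) (≤-reflexive (suc-injective e))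
  lemma₁ : ∀ g P j → (P + g * P) * j ≡ P * (j + g * j)
  lemma₁ = solve-∀
  lemma₂ : ∀ g P j → P * (g + g * j) ≡ g * (P * suc j)
  lemma₂ = solve-∀

-- An elementary stand-in for `(1 + 1/g) ^ g < e`: for the exponent `m = g/2`, `bernoulli` gives at
-- most 2, and this is squared.
[1+1/g]^g≤4 : ∀ m → suc (m + m) ^ (m + m) ≤ 4 * (m + m) ^ (m + m)
[1+1/g]^g≤4 m = begin
  suc g ^ (m + m)              ≡⟨ ^-distribˡ-+-* (suc g) m m ⟩
  suc g ^ m * suc g ^ m        ≤⟨ *-mono-≤ half half ⟩
  2 * g ^ m * (2 * g ^ m)      ≡⟨ lemma₂ (g ^ m) ⟩
  4 * (g ^ m * g ^ m)          ≡⟨ cong (4 *_) (sym (^-distribˡ-+-* g m m)) ⟩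
  4 * g ^ (m + m)              ∎
  where
  open ≤-Reasoning
  g = m + m
  lemma₁ : ∀ m P → P * suc (m + m) + P ≡ 2 * P * suc m
  lemma₁ = solve-∀
  lemma₂ : ∀ P → 2 * P * (2 * P) ≡ 4 * (P * P)
  lemma₂ = solve-∀
  half : suc g ^ m ≤ 2 * g ^ m
  half = *-cancelʳ-≤ _ _ (suc m) (begin
    suc g ^ m * suc m       ≤⟨ bernoulli g m (suc m) (+-suc m m) ⟩
    g ^ m * suc g           ≤⟨ m≤m+n _ (g ^ m) ⟩
    g ^ m * suc g + g ^ m   ≡⟨ lemma₁ m (g ^ m) ⟩
    2 * g ^ m * suc m       ∎)

m+m≢0 : ∀ m .{{_ : NonZero m}} → NonZero (m + m)
m+m≢0 (suc m) = _

2*-< : ∀ P E M → 1 ≤ P → 0 < M → 2 * P * E ≤ M → E < M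
2*-< P zero    M 1≤P 0<M h = 0<M
2*-< P (suc e) M 1≤P 0<M h = ≤-trans (begin
  suc (suc e)            ≤⟨ m≤m+n (suc (suc e)) e ⟩
  suc (suc e) + e        ≡⟨ lemma e ⟩
  2 * 1 * suc e          ≤⟨ *-monoˡ-≤ (suc e) (*-monoʳ-≤ 2 1≤P) ⟩
  2 * P * suc e          ∎) h
  where
  open ≤-Reasoning
  lemma : ∀ e → suc (suc e) + e ≡ 2 * 1 * suc e
  lemma = solve-∀

-- The last hypothesis says `E ≤ l ^ N * (g * g / Q) ^ n * (1 + 1/g) ^ (2 * N)` with `N = g *
-- n`. The last factor is at most `16 ^ n`, so `Q ≥ 32 * g * g` leaves a factor `2 ^ (- n)`.
few-chains : ∀ g n l Q E .{{_ : NonZero g}} .{{_ : NonZero n}} .{{_ : NonZero l}} →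
  suc g ^ g ≤ 4 * g ^ g → 32 * (g * g) ≤ Q →
  g ^ (g * n) * (g ^ (g * n) * (Q ^ n * E)) ≤
    l ^ (g * n) * (g * g) ^ n * suc g ^ (g * n) * suc g ^ (g * n) →
  E < l ^ (g * n)
few-chains g n@(suc n-1) l Q E e≤4 32g²≤Q h =
  2*-< (2 ^ n-1) E M (m^n>0 2 n-1) (m^n>0 l N) 2E≤M
  where
  open ≤-Reasoning
  N = g * n
  M = l ^ N
  G = g ^ N
  F = 4 ^ n
  X = (g * g) ^ n
  W = F * F * X
  sucg^N : suc g ^ N ≤ F * G
  sucg^N = begin
    suc g ^ (g * n)       ≡⟨ sym (^-*-assoc (suc g) g n) ⟩
    (suc g ^ g) ^ n       ≤⟨ ^-monoˡ-≤ n e≤4 ⟩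
    (4 * g ^ g) ^ n       ≡⟨ power-product 4 (g ^ g) n ⟩
    F * (g ^ g) ^ n       ≡⟨ cong (F *_) (^-*-assoc g g n) ⟩
    F * G                 ∎
  instance
    G≢0 : NonZero (G * G)
    G≢0 = m*n≢0 G G {{m^n≢0 g N}} {{m^n≢0 g N}}
    X≢0 : NonZero X
    X≢0 = m^n≢0 (g * g) n {{m*n≢0 g g}}
    W≢0 : NonZero W
    W≢0 = m*n≢0 (F * F) X {{m*n≢0 F F {{m^n≢0 4 n}} {{m^n≢0 4 n}}}}
  lemma₁ : ∀ G Q E → G * G * (Q * E) ≡ G * (G * (Q * E))
  lemma₁ = solve-∀
  lemma₂ : ∀ M X F G → M * X * (F * G) * (F * G) ≡ G * G * (M * (F * F * X))
  lemma₂ = solve-∀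
  lemma₃ : ∀ P E F X → P * E * (F * F * X) ≡ P * (F * F * X) * E
  lemma₃ = solve-∀
  32g²^n : (32 * (g * g)) ^ n ≡ 2 ^ n * W
  32g²^n = begin-equality
    (32 * (g * g)) ^ n          ≡⟨ power-product 32 (g * g) n ⟩
    32 ^ n * X                  ≡⟨ cong (_* X) (trans (power-product 2 16 n)
                                     (cong (2 ^ n *_) (power-product 4 4 n))) ⟩
    2 ^ n * (F * F) * X         ≡⟨ *-assoc (2 ^ n) (F * F) X ⟩
    2 ^ n * W                   ∎
  QE≤MW : Q ^ n * E ≤ M * W
  QE≤MW = *-cancelˡ-≤ (G * G) (begin
    G * G * (Q ^ n * E)                      ≡⟨ lemma₁ G (Q ^ n) E ⟩
    G * (G * (Q ^ n * E))                    ≤⟨ h ⟩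
    M * X * suc g ^ N * suc g ^ N            ≤⟨ *-mono-≤ (*-monoʳ-≤ (M * X) sucg^N) sucg^N ⟩
    M * X * (F * G) * (F * G)                ≡⟨ lemma₂ M X F G ⟩
    G * G * (M * W)                          ∎)
  2E≤M : 2 ^ n * E ≤ M
  2E≤M = *-cancelʳ-≤ _ _ W (begin
    2 ^ n * E * W             ≡⟨ lemma₃ (2 ^ n) E F X ⟩
    2 ^ n * W * E             ≡⟨ cong (_* E) (sym 32g²^n) ⟩
    (32 * (g * g)) ^ n * E    ≤⟨ *-monoˡ-≤ E (^-monoˡ-≤ n 32g²≤Q) ⟩
    Q ^ n * E                 ≤⟨ QE≤MW ⟩
    M * W                     ∎)

module Chains {Ω : Set} (d : Ω) (R : Ω → Ω → Bool) where

  -- The pairs of positions decrease strictly in both coordinates from the outermost one, which lies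
  -- below `(p , q)`. Diagonal pairs are excluded: there `R` compares a letter with itself, which is
  -- no rare event.
  data Chain {N : ℕ} (w : Vec Ω N) : ℕ → ℕ → ℕ → Set where
    []  : ∀ {p q} → Chain w 0 p q
    add : ∀ {n p q a b} → a < p → b < q → a ≢ b → R (at d w a) (at d w b) ≡ true →
          Chain w n a b → Chain w (suc n) p q

  weaken : ∀ {N} {w : Vec Ω N} {n p q p′ q′} → p ≤ p′ → q ≤ q′ → Chain w n p q → Chain w n p′ q′
  weaken p≤ q≤ []                  = []
  weaken p≤ q≤ (add a< b< a≢b r c) = add (≤-trans a< p≤) (≤-trans b< q≤) a≢b r c

  shorten : ∀ {N} {w : Vec Ω N} {n m p q} → m ≤ n → Chain w n p q → Chain w m p q
  shorten z≤n       c                   = []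
  shorten (s≤s m≤n) (add a< b< a≢b r c) = add a< b< a≢b r (shorten m≤n c)

  hit : ∀ {N} → Vec Ω N → ℕ → ℕ → ℕ
  hit w a b with a ≟ b
  ... | yes _ = 0
  ... | no  _ = 𝟙 (R (at d w a) (at d w b))

  hit-diag : ∀ {N} (w : Vec Ω N) a → hit w a a ≡ 0
  hit-diag w a with a ≟ a
  ... | yes _   = refl
  ... | no  a≢a = contradiction refl a≢a

  hit-off : ∀ {N} (w : Vec Ω N) {a b} → a ≢ b → hit w a b ≡ 𝟙 (R (at d w a) (at d w b))
  hit-off w {a} {b} a≢b with a ≟ b
  ... | yes a≡b = contradiction a≡b a≢b
  ... | no  _   = refl

  chains : ∀ {N} → ℕ → Vec Ω N → ℕ → ℕ → ℕ
  chains zero    w p q = 1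
  chains (suc n) w p q = ∑ (downFrom p) λ a → ∑ (downFrom q) λ b → hit w a b * chains n w a b

  Chain⇒chains : ∀ {N} {w : Vec Ω N} {n p q} → Chain w n p q → 1 ≤ chains n w p q
  Chain⇒chains []                              = ≤-refl
  Chain⇒chains {w = w} {suc n} {p} {q} (add {a = a} {b = b} a< b< a≢b r c) = begin
    1                                           ≤⟨ Chain⇒chains c ⟩
    chains n w a b                              ≡⟨ sym (*-identityˡ _) ⟩
    1 * chains n w a b                          ≡⟨ cong (_* chains n w a b) (sym hit≡1) ⟩
    hit w a b * chains n w a b                  ≤⟨ ∑-downFrom-term b< _ ⟩
    ∑ (downFrom q) (λ b → hit w a b * chains n w a b)
                                                ≤⟨ ∑-downFrom-term a< _ ⟩
    chains (suc n) w p q                        ∎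
    where
    open ≤-Reasoning
    hit≡1 : hit w a b ≡ 1
    hit≡1 = trans (hit-off w a≢b) (cong 𝟙 r)

  -- All letters that are read lie at positions below `p` or `q`, hence below `c`. This is the
  -- independence that lets the letter at `c` be resampled.
  chains-set : ∀ {N} (w : Vec Ω N) {c} x n {p q} → p ≤ c → q ≤ c →
               chains n (set w c x) p q ≡ chains n w p q
  chains-set w         x zero    p≤c q≤c = refl
  chains-set w {c = c} x (suc n) {p} {q} p≤c q≤c =
    ∑-downFrom-cong p λ a<p → ∑-downFrom-cong q λ b<q →
    cong₂ _*_ (hit-set (<-≤-trans a<p p≤c) (<-≤-trans b<q q≤c))
              (chains-set w x n (<⇒≤ (<-≤-trans a<p p≤c)) (<⇒≤ (<-≤-trans b<q q≤c)))
    where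
    hit-set : ∀ {a b} → a < c → b < c → hit (set w c x) a b ≡ hit w a b
    hit-set {a} {b} a<c b<c with a ≟ b
    ... | yes _ = refl
    ... | no  _ = cong 𝟙 (cong₂ R (at-set-other d w x (>⇒≢ a<c)) (at-set-other d w x (>⇒≢ b<c)))

  -- A uniformly random letter is related to a fixed one with probability at most `1 / Q`, on either
  -- side, since either member of a pair can have the larger index.
  module Counting (xs : List Ω) .{{_ : NonZero (length xs)}} (Q : ℕ)
                  (rareˡ : ∀ y → Q * ∑ xs (λ x → 𝟙 (R x y)) ≤ length xs)
                  (rareʳ : ∀ y → Q * ∑ xs (λ x → 𝟙 (R y x)) ≤ length xs) where

    total : ∀ (N n p q : ℕ) → ℕ
    total N n p q = ∑ (allVec xs N) (λ w → chains n w p q)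

    private
      -- For a ≠ b the letter with the larger index occurs in no other factor.
      factor : ∀ (φ : Ω → ℕ) C → Q * ∑ xs φ ≤ length xs →
               Q * ∑ xs (λ x → φ x * C) ≤ length xs * C
      factor φ C h = begin
        Q * ∑ xs (λ x → φ x * C)  ≡⟨ cong (Q *_) (∑-distribʳ-* xs C φ) ⟩
        Q * (∑ xs φ * C)          ≡⟨ sym (*-assoc Q _ C) ⟩
        Q * ∑ xs φ * C            ≤⟨ *-monoˡ-≤ C h ⟩
        length xs * C             ∎
        where open ≤-Reasoning

    pair-total : ∀ N n {a b} → a < N → b < N →
                 Q * ∑ (allVec xs N) (λ w → hit w a b * chains n w a b) ≤ total N n a b
    pair-total N n {a} {b} a<N b<N with <-cmp a b
    ... | tri≈ _ refl _ = ≤-trans (≤-reflexive (begin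
        Q * ∑ W (λ w → hit w a a * chains n w a a)
          ≡⟨ cong (Q *_) (∑-cong W (λ w → cong (_* chains n w a a) (hit-diag w a))) ⟩
        Q * ∑ W (λ _ → 0)   ≡⟨ cong (Q *_) (∑-const W 0) ⟩
        Q * (length W * 0)  ≡⟨ cong (Q *_) (*-zeroʳ (length W)) ⟩
        Q * 0               ≡⟨ *-zeroʳ Q ⟩
        0                   ∎)) z≤n
      where
      open ≡-Reasoning
      W = allVec xs N
    ... | tri< a<b a≢b _ = resample-≤ xs {Q = Q} b<N
        (λ w → hit w a b * chains n w a b) (λ w → chains n w a b) λ w → begin
        Q * ∑ xs (λ x → hit (set w b x) a b * chains n (set w b x) a b)
          ≡⟨ cong (Q *_) (∑-cong xs λ x → cong₂ _*_
               (trans (hit-off (set w b x) a≢b)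
                 (cong₂ (λ y z → 𝟙 (R y z)) (at-set-other d w x (>⇒≢ a<b)) (at-set-same d w x b<N)))
               (chains-set w x n (<⇒≤ a<b) ≤-refl)) ⟩
        Q * ∑ xs (λ x → 𝟙 (R (at d w a) x) * chains n w a b)
          ≤⟨ factor _ _ (rareʳ (at d w a)) ⟩
        length xs * chains n w a b ∎
      where open ≤-Reasoning
    ... | tri> _ a≢b b<a = resample-≤ xs {Q = Q} a<N
        (λ w → hit w a b * chains n w a b) (λ w → chains n w a b) λ w → begin
        Q * ∑ xs (λ x → hit (set w a x) a b * chains n (set w a x) a b)
          ≡⟨ cong (Q *_) (∑-cong xs λ x → cong₂ _*_
               (trans (hit-off (set w a x) a≢b)
                 (cong₂ (λ y z → 𝟙 (R y z)) (at-set-same d w x a<N) (at-set-other d w x (>⇒≢ b<a))))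
               (chains-set w x n ≤-refl (<⇒≤ b<a))) ⟩
        Q * ∑ xs (λ x → 𝟙 (R x (at d w b)) * chains n w a b)
          ≤⟨ factor _ _ (rareˡ (at d w b)) ⟩
        length xs * chains n w a b ∎
      where open ≤-Reasoning

    -- There are at most `C(p,n) * C(q,n)` candidates, each a chain with probability at most
    -- `Q ^ (- n)`. The binomials enter through `C(p,n) ≤ g ^ n * (1 + 1/g) ^ p`, a form that
    -- geometric sums reproduce when a pair is added.
    total-bound : ∀ N g n {p q} → p ≤ N → q ≤ N →
                  g ^ p * (g ^ q * (Q ^ n * total N n p q)) ≤
                  length xs ^ N * (g * g) ^ n * suc g ^ q * suc g ^ p
    total-bound N g zero {p} {q} p≤N q≤N = begin
      g ^ p * (g ^ q * (1 * total N 0 p q))  ≡⟨ cong (λ t → g ^ p * (g ^ q * (1 * t))) total≡ ⟩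
      g ^ p * (g ^ q * (1 * M))              ≡⟨ lemma (g ^ p) (g ^ q) M ⟩
      M * 1 * g ^ q * g ^ p                  ≤⟨ *-mono-≤ (*-monoʳ-≤ (M * 1) (^-monoˡ-≤ q (n≤1+n g)))
                                                         (^-monoˡ-≤ p (n≤1+n g)) ⟩
      M * 1 * suc g ^ q * suc g ^ p          ∎
      where
      open ≤-Reasoning
      M = length xs ^ N
      total≡ : total N 0 p q ≡ M
      total≡ = trans (∑-const (allVec xs N) 1) (trans (*-identityʳ _) (length-allVec xs N))
      lemma : ∀ a b c → a * (b * (1 * c)) ≡ c * 1 * b * a
      lemma = solve-∀
    total-bound N g (suc n) {p} {q} p≤N q≤N = begin
      g ^ p * (g ^ q * (Q ^ suc n * total N (suc n) p q))
        ≡⟨ cong (λ t → g ^ p * (g ^ q * (Q ^ suc n * t))) expand ⟩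
      g ^ p * (g ^ q * (Q ^ suc n * ∑ (downFrom p) (λ a → ∑ (downFrom q) (pair a))))
        ≡⟨ cong (g ^ p *_) (trans (sym (*-assoc (g ^ q) (Q ^ suc n) _))
             (sym (∑-distribˡ-* (downFrom p) (g ^ q * Q ^ suc n) _))) ⟩
      g ^ p * ∑ (downFrom p) (λ a → g ^ q * Q ^ suc n * ∑ (downFrom q) (pair a))
        ≤⟨ m+n≤o⇒m≤o _ (∑-geometric g (K * g * suc g ^ q) p _ outer) ⟩
      K * g * suc g ^ q * g * suc g ^ p
        ≡⟨ lemma₃ (length xs ^ N) g ((g * g) ^ n) (suc g ^ q) (suc g ^ p) ⟩
      length xs ^ N * (g * g) ^ suc n * suc g ^ q * suc g ^ p ∎
      where
      open ≤-Reasoning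
      W = allVec xs N
      K = length xs ^ N * (g * g) ^ n
      pair : ℕ → ℕ → ℕ
      pair a b = ∑ W (λ w → hit w a b * chains n w a b)
      expand : total N (suc n) p q ≡ ∑ (downFrom p) (λ a → ∑ (downFrom q) (pair a))
      expand = trans (∑-swap W (downFrom p) _)
                     (∑-cong (downFrom p) (λ a → ∑-swap W (downFrom q) _))
      lemma₁ : ∀ a b Q P t → a * (b * (Q * P * t)) ≡ a * (b * (P * (Q * t)))
      lemma₁ = solve-∀
      lemma₂ : ∀ a q Q s → a * (q * Q * s) ≡ q * (a * Q * s)
      lemma₂ = solve-∀
      lemma₂′ : ∀ b a Q s → b * (a * Q * s) ≡ a * (b * (Q * s))
      lemma₂′ = solve-∀
      lemma₃ : ∀ M g X S T → M * X * g * S * g * T ≡ M * (g * g * X) * S * T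
      lemma₃ = solve-∀
      lemma₄ : ∀ K S g T → K * S * g * T ≡ K * g * T * S
      lemma₄ = solve-∀
      lemma₅ : ∀ K S T → K * S * T ≡ K * T * S
      lemma₅ = solve-∀
      inner : ∀ {a} → a < p → ∀ {b} → b < q →
              g ^ b * (g ^ a * Q ^ suc n * pair a b) ≤ K * suc g ^ a * suc g ^ b
      inner {a} a<p {b} b<q = begin
        g ^ b * (g ^ a * Q ^ suc n * pair a b)   ≡⟨ lemma₂′ (g ^ b) (g ^ a) (Q ^ suc n) (pair a b) ⟩
        g ^ a * (g ^ b * (Q * Q ^ n * pair a b)) ≡⟨ lemma₁ (g ^ a) (g ^ b) Q (Q ^ n) (pair a b) ⟩
        g ^ a * (g ^ b * (Q ^ n * (Q * pair a b)))
          ≤⟨ *-monoʳ-≤ (g ^ a) (*-monoʳ-≤ (g ^ b) (*-monoʳ-≤ (Q ^ n)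
               (pair-total N n (<-≤-trans a<p p≤N) (<-≤-trans b<q q≤N)))) ⟩
        g ^ a * (g ^ b * (Q ^ n * total N n a b))
          ≤⟨ total-bound N g n (<⇒≤ (<-≤-trans a<p p≤N)) (<⇒≤ (<-≤-trans b<q q≤N)) ⟩
        K * suc g ^ b * suc g ^ a                ≡⟨ lemma₅ K (suc g ^ b) (suc g ^ a) ⟩
        K * suc g ^ a * suc g ^ b                ∎
      outer : ∀ {a} → a < p → g ^ a * (g ^ q * Q ^ suc n * ∑ (downFrom q) (pair a)) ≤
              K * g * suc g ^ q * suc g ^ a
      outer {a} a<p = begin
        g ^ a * (g ^ q * Q ^ suc n * ∑ (downFrom q) (pair a))
          ≡⟨ lemma₂ (g ^ a) (g ^ q) (Q ^ suc n) _ ⟩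
        g ^ q * (g ^ a * Q ^ suc n * ∑ (downFrom q) (pair a))
          ≡⟨ cong (g ^ q *_) (sym (∑-distribˡ-* (downFrom q) (g ^ a * Q ^ suc n) (pair a))) ⟩
        g ^ q * ∑ (downFrom q) (λ b → g ^ a * Q ^ suc n * pair a b)
          ≤⟨ m+n≤o⇒m≤o _ (∑-geometric g (K * suc g ^ a) q _ (inner a<p)) ⟩
        K * suc g ^ a * g * suc g ^ q
          ≡⟨ lemma₄ K (suc g ^ a) g (suc g ^ q) ⟩
        K * g * suc g ^ q * suc g ^ a ∎

    -- With `g = m + m = N / n` the expected number of chains of length `n` is below 1. Thus chains
    -- can be kept shorter than `N / g`, where `g` may be of the order of the square root of `Q`.
    word-without-long-chain : ∀ m n .{{_ : NonZero m}} .{{_ : NonZero n}} →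
      32 * ((m + m) * (m + m)) ≤ Q →
      ∃ λ (w : Vec Ω ((m + m) * n)) → ¬ Chain w n ((m + m) * n) ((m + m) * n)
    word-without-long-chain m n 32g²≤Q =
      let w , none = ∑<length⇒∃0 (allVec xs N) (λ w → chains n w N N)
                       (subst (total N n N N <_) (sym (length-allVec xs N)) few)
      in w , λ c → contradiction (subst (1 ≤_) none (Chain⇒chains c)) λ ()
      where
      open ≤-Reasoning
      g = m + m
      N = g * n
      M = length xs ^ N
      few : total N n N N < M
      few = few-chains g n (length xs) Q (total N n N N) {{m+m≢0 m}} ([1+1/g]^g≤4 m) 32g²≤Q
              (total-bound N g n ≤-refl ≤-refl)

-- Binary strings

Bits : Set
Bits = List Bool

-- `k` is the level of an edge. The order of the two digits is fixed, so that the first end is the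
-- smaller one.
data Split : ℕ → Bits → Bits → Set where
  here  : ∀ {x y} → Split 0 (false ∷ x) (true ∷ y)
  there : ∀ {k c x y} → Split k x y → Split (suc k) (c ∷ x) (c ∷ y)

Split-irrefl : ∀ {k x} → ¬ Split k x x
Split-irrefl (there s) = Split-irrefl s

-- Digit `k` of `y` would be 1 after the first step and 0 before the second.
Split-no-repeat : ∀ {k x y z} → Split k x y → ¬ Split k y z
Split-no-repeat (there s) (there s′) = Split-no-repeat s s′

Split⇒<length : ∀ {k x y} → Split k x y → k < length x
Split⇒<length here      = s≤s z≤n
Split⇒<length (there s) = s≤s (Split⇒<length s)

Split⇒take : ∀ {k x y} → Split k x y → take k x ≡ take k y
Split⇒take here      = refl
Split⇒take (there s) = cong (_ ∷_) (Split⇒take s)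

splitLevel : Bits → Bits → ℕ
splitLevel (x ∷ xs) (y ∷ ys) with x ≟ᵇ y
... | yes _ = suc (splitLevel xs ys)
... | no  _ = 0
splitLevel _        _        = 0

Split⇒splitLevel : ∀ {k x y} → Split k x y → splitLevel x y ≡ k
Split⇒splitLevel here = refl
Split⇒splitLevel (there {c = c} s) with c ≟ᵇ c
... | yes _   = cong suc (Split⇒splitLevel s)
... | no  c≢c = contradiction refl c≢c

-- Most significant digit first, so that Split follows the order of the numbers.
bits : ℕ → ℕ → Bits
bits zero    o = []
bits (suc d) o with o <? 2 ^ d
... | yes _ = false ∷ bits d o
... | no  _ = true ∷ bits d (o ∸ 2 ^ d)

length-bits : ∀ d o → length (bits d o) ≡ d
length-bits zero    o = refl
length-bits (suc d) o with o <? 2 ^ d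
... | yes _ = cong suc (length-bits d o)
... | no  _ = cong suc (length-bits d (o ∸ 2 ^ d))

bits-split : ∀ d {o o′} → o < o′ → o′ < 2 ^ d → ∃ λ k → Split k (bits d o) (bits d o′)
bits-split zero    {o} {zero}   () o′<
bits-split zero    {o} {suc o′} o< (s≤s ())
bits-split (suc d) {o} {o′} o<o′ o′< with o <? 2 ^ d | o′ <? 2 ^ d
... | yes _  | yes p′ = let k , s = bits-split d o<o′ p′ in suc k , there s
... | yes _  | no  _  = 0 , here
... | no  p  | yes p′ = contradiction (<-trans o<o′ p′) p
... | no  p  | no  p′ =
  let k , s = bits-split d (∸-monoˡ-< o<o′ (≮⇒≥ p))
                (m<n+o⇒m∸n<o o′ (2 ^ d) {{m^n≢0 2 d}} (subst (λ t → o′ < 2 ^ d + t) (+-identityʳ _) o′<))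
  in suc k , there s

bits-injective : ∀ d {o o′} → o < 2 ^ d → o′ < 2 ^ d → bits d o ≡ bits d o′ → o ≡ o′
bits-injective d {o} {o′} o< o′< e with <-cmp o o′
... | tri≈ _ o≡o′ _ = o≡o′
... | tri< o<o′ _ _ with bits-split d o<o′ o′<
...   | k , s rewrite e = contradiction s Split-irrefl
bits-injective d {o} {o′} o< o′< e | tri> _ _ o′<o with bits-split d o′<o o<
...   | k , s rewrite e = contradiction s Split-irrefl

-- A leading 1 is appended beyond the last bit, which makes code injective on strings of all lengths.
code : Bits → ℕ
code []           = 1
code (false ∷ bs) = code bs + code bs
code (true  ∷ bs) = suc (code bs + code bs)

code>0 : ∀ bs → 0 < code bs
code>0 []           = s≤s z≤n
code>0 (false ∷ bs) = ≤-trans (code>0 bs) (m≤m+n _ _)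
code>0 (true  ∷ bs) = s≤s z≤n

double-injective : ∀ m n → m + m ≡ n + n → m ≡ n
double-injective zero    zero    e = refl
double-injective (suc m) (suc n) e =
  cong suc (double-injective m n (suc-injective (trans (sym (+-suc m m)) (trans (suc-injective e) (+-suc n n)))))

double≢odd : ∀ m n → m + m ≢ suc (n + n)
double≢odd (suc m) n e = double≢odd n m (sym (trans (sym (+-suc m m)) (suc-injective e)))

code-injective : ∀ xs ys → code xs ≡ code ys → xs ≡ ys
code-injective []           []           e = refl
code-injective []           (false ∷ ys) e = contradiction (sym e) (double≢odd (code ys) 0)
code-injective []           (true  ∷ ys) e = contradiction (suc-injective e) (<⇒≢ (≤-trans (code>0 ys) (m≤m+n _ _)))
code-injective (false ∷ xs) []           e = contradiction e (double≢odd (code xs) 0)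
code-injective (true  ∷ xs) []           e = contradiction (sym (suc-injective e)) (<⇒≢ (≤-trans (code>0 xs) (m≤m+n _ _)))
code-injective (false ∷ xs) (false ∷ ys) e = cong (false ∷_) (code-injective xs ys (double-injective _ _ e))
code-injective (false ∷ xs) (true  ∷ ys) e = contradiction e (double≢odd (code xs) (code ys))
code-injective (true  ∷ xs) (false ∷ ys) e = contradiction (sym e) (double≢odd (code ys) (code xs))
code-injective (true  ∷ xs) (true  ∷ ys) e = cong (true ∷_) (code-injective xs ys (double-injective _ _ (suc-injective e)))

code-bound : ∀ bs → code bs < 2 ^ suc (length bs)
code-bound []           = s≤s (s≤s z≤n)
code-bound (false ∷ bs) = subst (code bs + code bs <_) (cong (2 ^ suc (length bs) +_) (sym (+-identityʳ _)))
                            (+-mono-< (code-bound bs) (code-bound bs))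
code-bound (true  ∷ bs) = subst (suc (suc (code bs + code bs)) ≤_) (cong (2 ^ suc (length bs) +_) (sym (+-identityʳ _)))
                            (subst (_≤ 2 ^ suc (length bs) + 2 ^ suc (length bs)) (cong suc (+-suc (code bs) (code bs)))
                              (+-mono-≤ (code-bound bs) (code-bound bs)))

++-injective : ∀ {xs xs′ ys ys′ : Bits} → length xs ≡ length xs′ → xs ++ ys ≡ xs′ ++ ys′ → xs ≡ xs′ × ys ≡ ys′
++-injective {[]}     {[]}       l e = refl , e
++-injective {x ∷ xs} {x′ ∷ xs′} l e =
  let x≡ , r = ∷-injective e
      xs≡ , ys≡ = ++-injective (suc-injective l) r
  in cong₂ _∷_ x≡ xs≡ , ys≡

-- Self-delimiting: `j` zeros closed by a 1, so that `j` can be read off before the lengths of later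
-- parts are known.
unary : ℕ → Bits → Bits
unary zero    bs = true ∷ bs
unary (suc j) bs = false ∷ unary j bs

unary-injective : ∀ j j′ {bs bs′} → unary j bs ≡ unary j′ bs′ → j ≡ j′ × bs ≡ bs′
unary-injective zero    zero     e = refl , proj₂ (∷-injective e)
unary-injective zero    (suc j′) ()
unary-injective (suc j) zero     ()
unary-injective (suc j) (suc j′) e =
  let j≡ , bs≡ = unary-injective j j′ (proj₂ (∷-injective e)) in cong suc j≡ , bs≡

length-unary : ∀ j bs → length (unary j bs) ≡ suc j + length bs
length-unary zero    bs = refl
length-unary (suc j) bs = cong suc (length-unary j bs)

count : Bits → ℕ
count []           = 0
count (true  ∷ ms) = suc (count ms)
count (false ∷ ms) = count ms

data True : ℕ → Bits → Set where
  here  : ∀ {ms} → True 0 (true ∷ ms)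
  there : ∀ {k m ms} → True k ms → True (suc k) (m ∷ ms)

-- The digits of `w` at the marked places, read as a binary number. It serves as a clock that moves
-- forward with every step at a marked level.
masked : Bits → Bits → ℕ
masked []           w           = 0
masked (m ∷ ms)     []          = 0
masked (false ∷ ms) (b ∷ w)     = masked ms w
masked (true  ∷ ms) (false ∷ w) = masked ms w
masked (true  ∷ ms) (true  ∷ w) = 2 ^ count ms + masked ms w

masked-bound : ∀ ms w → masked ms w < 2 ^ count ms
masked-bound []           w           = s≤s z≤n
masked-bound (m ∷ ms)     []          = m^n>0 2 (count (m ∷ ms))
masked-bound (false ∷ ms) (b ∷ w)     = masked-bound ms w
masked-bound (true  ∷ ms) (false ∷ w) = ≤-trans (masked-bound ms w) (m≤m+n _ _)
masked-bound (true  ∷ ms) (true  ∷ w) = subst (suc (2 ^ count ms + masked ms w) ≤_)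
  (cong (2 ^ count ms +_) (sym (+-identityʳ _))) (+-monoʳ-< (2 ^ count ms) (masked-bound ms w))

-- The first digit that changes is marked and goes from 0 to 1; all marked digits after it together
-- weigh less.
masked-< : ∀ {k ms x y} → Split k x y → True k ms → masked ms x < masked ms y
masked-< {ms = _ ∷ ms} (here {x} {y}) here = ≤-trans (masked-bound ms x) (m≤m+n _ _)
masked-< {ms = false ∷ ms} (there s) (there t) = masked-< s t
masked-< {ms = true ∷ ms} (there {c = false} s) (there t) = masked-< s t
masked-< {ms = true ∷ ms} (there {c = true}  s) (there t) = +-monoʳ-< (2 ^ count ms) (masked-< s t)

masked-≡ : ∀ ms {k x y} → Split k x y → length ms ≤ k → masked ms x ≡ masked ms y
masked-≡ []           s                     l       = refl
masked-≡ (false ∷ ms) (there s)             (s≤s l) = masked-≡ ms s l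
masked-≡ (true  ∷ ms) (there {c = false} s) (s≤s l) = masked-≡ ms s l
masked-≡ (true  ∷ ms) (there {c = true}  s) (s≤s l) = cong (2 ^ count ms +_) (masked-≡ ms s l)

True-++ˡ : ∀ {k ms} ms′ → True k ms → True k (ms ++ ms′)
True-++ˡ ms′ here      = here
True-++ˡ ms′ (there t) = there (True-++ˡ ms′ t)

True-++ʳ : ∀ ms {k ms′} → True k ms′ → True (length ms + k) (ms ++ ms′)
True-++ʳ []       t = t
True-++ʳ (m ∷ ms) t = there (True-++ʳ ms t)

True-replicate : ∀ {k n} → k < n → True k (replicate n true)
True-replicate {zero}  {suc n} (s≤s _)   = here
True-replicate {suc k} {suc n} (s≤s k<n) = there (True-replicate k<n)

count-replicate : ∀ n → count (replicate n true) ≡ n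
count-replicate zero    = refl
count-replicate (suc n) = cong suc (count-replicate n)

count-++ : ∀ xs ys → count (xs ++ ys) ≡ count xs + count ys
count-++ []           ys = refl
count-++ (true  ∷ xs) ys = cong suc (count-++ xs ys)
count-++ (false ∷ xs) ys = count-++ xs ys

slice : ℕ → ℕ → Bits → Bits
slice s l w = take l (drop s w)

take-slice : ∀ s l {m} w w′ → s + l ≤ m → take m w ≡ take m w′ → slice s l w ≡ slice s l w′
take-slice zero    zero    w       w′        h e = refl
take-slice zero    (suc l) []      []        (s≤s h) e = refl
take-slice zero    (suc l) (x ∷ w) (x′ ∷ w′) (s≤s h) e =
  let x≡ , e′ = ∷-injective e in cong₂ _∷_ x≡ (take-slice zero l w w′ h e′)
take-slice (suc s) l       []      []        (s≤s h) e = refl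
take-slice (suc s) l       (x ∷ w) (x′ ∷ w′) (s≤s h) e = take-slice s l w w′ h (proj₂ (∷-injective e))

drop-slice : ∀ {e s} l w w′ → e ≤ s → drop e w ≡ drop e w′ → slice s l w ≡ slice s l w′
drop-slice {e} {s} l w w′ e≤s h = cong (take l) (trans (sym (shift w)) (trans (cong (drop (s ∸ e)) h) (shift w′)))
  where
  shift : ∀ w → drop (s ∸ e) (drop e w) ≡ drop s w
  shift w = trans (drop-drop e (s ∸ e) w) (cong (λ t → drop t w) (m+[n∸m]≡n e≤s))

slices-injective : ∀ s l l′ w w′ → take s w ≡ take s w′ → slice s l w ≡ slice s l w′ →
                   slice (s + l) l′ w ≡ slice (s + l) l′ w′ → drop (s + l + l′) w ≡ drop (s + l + l′) w′ → w ≡ w′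
slices-injective s l l′ w w′ e₁ e₂ e₃ e₄ =
  join s e₁ (join′ s l e₂ (join′ (s + l) l′ e₃ e₄))
  where
  join : ∀ s → take s w ≡ take s w′ → drop s w ≡ drop s w′ → w ≡ w′
  join s e e′ = trans (sym (take++drop≡id s w)) (trans (cong₂ _++_ e e′) (take++drop≡id s w′))
  join′ : ∀ s l → slice s l w ≡ slice s l w′ → drop (s + l) w ≡ drop (s + l) w′ → drop s w ≡ drop s w′
  join′ s l e e′ = trans (sym (take++drop≡id l (drop s w)))
    (trans (cong₂ _++_ e (trans (drop-drop s l w) (trans e′ (sym (drop-drop s l w′)))))
           (take++drop≡id l (drop s w′)))

-- The colours of short edges

-- tier m = (j , α) where 64 + m = 2 ^ (j + 1) + α and α < 2 ^ (j + 1).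
tier : ℕ → ℕ × ℕ
tier zero    = 5 , 0
tier (suc m) with tier m
... | j , α with suc α <? 2 ^ suc j
...   | yes _ = j , suc α
...   | no  _ = suc j , 0

tier-sum : ∀ m → 2 ^ suc (proj₁ (tier m)) + proj₂ (tier m) ≡ 64 + m
tier-< : ∀ m → proj₂ (tier m) < 2 ^ suc (proj₁ (tier m))

tier-sum zero    = refl
tier-sum (suc m) with tier m | tier-sum m | tier-< m
... | j , α | e | l with suc α <? 2 ^ suc j
...   | yes _ = trans (+-suc (2 ^ suc j) α) (trans (cong suc e) (sym (+-suc 64 m)))
...   | no  p = begin
  2 ^ suc j + (2 ^ suc j + 0) + 0   ≡⟨ trans (+-identityʳ _) (cong (2 ^ suc j +_) (+-identityʳ _)) ⟩
  2 ^ suc j + 2 ^ suc j             ≡⟨ cong (2 ^ suc j +_) (sym (≤-antisym l (≮⇒≥ p))) ⟩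
  2 ^ suc j + suc α                 ≡⟨ +-suc (2 ^ suc j) α ⟩
  suc (2 ^ suc j + α)               ≡⟨ cong suc e ⟩
  suc (64 + m)                      ≡⟨ sym (+-suc 64 m) ⟩
  64 + suc m                        ∎
  where open ≡-Reasoning

tier-< zero    = s≤s z≤n
tier-< (suc m) with tier m | tier-< m
... | j , α | l with suc α <? 2 ^ suc j
...   | yes p = p
...   | no  _ = m^n>0 2 (suc (suc j))

tier-≥5 : ∀ m → 5 ≤ proj₁ (tier m)
tier-≥5 zero    = ≤-refl
tier-≥5 (suc m) with tier m | tier-≥5 m
... | j , α | l with suc α <? 2 ^ suc j
...   | yes _ = l
...   | no  _ = m≤n⇒m≤1+n l

tier-injective : ∀ m m′ → tier m ≡ tier m′ → m ≡ m′
tier-injective m m′ e = +-cancelˡ-≡ 64 m m′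
  (trans (sym (tier-sum m)) (trans (cong (λ t → 2 ^ suc (proj₁ t) + proj₂ t) e) (tier-sum m′)))

-- All levels in [2 ^ (j + 1) , 2 ^ (j + 2)) use the fields y and z at the digits from yStart j to
-- slotEnd j ≤ 2 ^ (j + 1); the slots of different tiers are disjoint.
yStart yLength zStart zLength slotEnd : ℕ → ℕ
yStart  j = 2 ^ j
yLength j = 2 * suc j
zStart  j = yStart j + yLength j
zLength j = 3 * suc j
slotEnd j = zStart j + zLength j

slotEnd-≤ : ∀ {j} → 5 ≤ j → slotEnd j ≤ 2 ^ suc j
slotEnd-≤ {j} 5≤j = begin
  2 ^ j + 2 * suc j + 3 * suc j   ≡⟨ lemma (2 ^ j) j ⟩
  2 ^ j + 5 * suc j               ≤⟨ +-monoʳ-≤ (2 ^ j) (bound (≤⇒≤′ 5≤j)) ⟩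
  2 ^ j + 2 ^ j                   ≡⟨ cong (2 ^ j +_) (sym (+-identityʳ _)) ⟩
  2 ^ suc j                       ∎
  where
  open ≤-Reasoning
  lemma : ∀ P j → P + 2 * suc j + 3 * suc j ≡ P + 5 * suc j
  lemma = solve-∀
  lemma′ : ∀ j → 5 * suc (suc j) ≡ 5 + 5 * suc j
  lemma′ = solve-∀
  bound : ∀ {j} → 5 ≤′ j → 5 * suc j ≤ 2 ^ j
  -- `30 ≤ 32`. One tier lower it would read `25 ≤ 16`, which is why short levels begin at
  -- `64 = 2 ^ 6`.
  bound ≤′-refl           = m≤m+n 30 2
  bound (≤′-step {j} 5≤j) = begin
    5 * suc (suc j)          ≡⟨ lemma′ j ⟩
    5 + 5 * suc j            ≤⟨ +-monoˡ-≤ (5 * suc j) (m≤m*n 5 (suc j)) ⟩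
    5 * suc j + 5 * suc j    ≤⟨ +-mono-≤ (bound 5≤j) (bound 5≤j) ⟩
    2 ^ j + 2 ^ j            ≡⟨ cong (2 ^ j +_) (sym (+-identityʳ _)) ⟩
    2 ^ suc j                ∎

-- The slot ends before the first digit that an edge of this level changes, so a step leaves the
-- slot of its own tier untouched.
slotEnd-≤-level : ∀ m → slotEnd (proj₁ (tier m)) ≤ 64 + m
slotEnd-≤-level m = ≤-trans (slotEnd-≤ (tier-≥5 m)) (≤-trans (m≤m+n _ _) (≤-reflexive (tier-sum m)))

Y Z : ℕ → Bits → Bits
Y j = slice (yStart j) (yLength j)
Z j = slice (zStart j) (zLength j)

blend : ℕ × ℕ → Bits → ℕ
blend (j , α) w = code (Z j w) + α * code (Y j w)

record SameReveal (t : ℕ × ℕ) (w w′ : Bits) : Set where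
  constructor reveal
  field
    before : take (yStart (proj₁ t)) w ≡ take (yStart (proj₁ t)) w′
    blends : blend t w ≡ blend t w′
    after  : drop (slotEnd (proj₁ t)) w ≡ drop (slotEnd (proj₁ t)) w′

-- Subtracting the equations gives `(β - α) * y = (β - α) * y′`: blends with two different slopes
-- determine `y`.
slope-unique : ∀ z z′ y y′ {α β} → α < β → z + α * y ≡ z′ + α * y′ → z + β * y ≡ z′ + β * y′ → y ≡ y′
slope-unique z z′ y y′ {α} {β} α<β e e′ with m≤n⇒∃[o]m+o≡n α<β
... | δ , refl = *-cancelˡ-≡ y y′ (suc δ) (+-cancelˡ-≡ (z + α * y) _ _ (begin
  z + α * y + suc δ * y      ≡⟨ lemma z α δ y ⟩
  z + (suc α + δ) * y        ≡⟨ e′ ⟩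
  z′ + (suc α + δ) * y′      ≡⟨ sym (lemma z′ α δ y′) ⟩
  z′ + α * y′ + suc δ * y′   ≡⟨ cong (_+ suc δ * y′) (sym e) ⟩
  z + α * y + suc δ * y′     ∎))
  where
  open ≡-Reasoning
  lemma : ∀ z α δ y → z + α * y + suc δ * y ≡ z + (suc α + δ) * y
  lemma = solve-∀

Y-preserved : ∀ m {a a′} → Split (64 + m) a a′ → Y (proj₁ (tier m)) a ≡ Y (proj₁ (tier m)) a′
Y-preserved m {a} {a′} s =
  take-slice (yStart j) (yLength j) a a′ (≤-trans (m≤m+n _ (zLength j)) (slotEnd-≤-level m)) (Split⇒take s)
  where j = proj₁ (tier m)

Z-preserved : ∀ m {a a′} → Split (64 + m) a a′ → Z (proj₁ (tier m)) a ≡ Z (proj₁ (tier m)) a′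
Z-preserved m {a} {a′} s = take-slice (zStart j) (zLength j) a a′ (slotEnd-≤-level m) (Split⇒take s)
  where j = proj₁ (tier m)

blend-preserved : ∀ m {a a′} → Split (64 + m) a a′ → blend (tier m) a ≡ blend (tier m) a′
blend-preserved m s = cong₂ (λ z y → code z + proj₂ (tier m) * code y) (Z-preserved m s) (Y-preserved m s)

-- If `y` agreed as well, the equal blends would give equal `z`, and all other digits are shown.
Y-differs : ∀ t {a b} → SameReveal t a b → a ≢ b → Y (proj₁ t) a ≢ Y (proj₁ t) b
Y-differs (j , α) {a} {b} r a≢b Y≡ =
  a≢b (slices-injective (yStart j) (yLength j) (zLength j) a b before Y≡
    (code-injective _ _ (+-cancelʳ-≡ (α * code (Y j a)) _ _
      (trans blends (cong (λ y → code (Z j b) + α * code y) (sym Y≡))))) after)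
  where open SameReveal r

-- The difference of a and b lies in the Y and Z of one tier, with a slope determined by the level;
-- a step at that level does not move it, and no two consecutive steps have the same level.
no-two-steps : ∀ m m′ {a b a′ b′ a″} → SameReveal (tier m) a b → a ≢ b →
               Split (64 + m) a a′ → Split (64 + m) b b′ →
               SameReveal (tier m′) a′ b′ → ¬ Split (64 + m′) a′ a″
no-two-steps m m′ {a} {b} {a′} {b′} r a≢b sa sb r′ sa′ with <-cmp (proj₁ (tier m)) (proj₁ (tier m′))
-- The slot of the lower tier lies before `yStart` of the higher one, so the second colour shows the
-- old `y` in full.
... | tri< j<j′ _ _ = Y≢ (take-slice (yStart j) (yLength j) a′ b′
        (≤-trans (≤-trans (m≤m+n _ (zLength j)) (slotEnd-≤ (tier-≥5 m))) (^-monoʳ-≤ 2 j<j′)) (SameReveal.before r′))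
  where
  j = proj₁ (tier m)
  Y≢ : Y j a′ ≢ Y j b′
  Y≢ e = Y-differs (tier m) r a≢b (trans (Y-preserved m sa) (trans e (sym (Y-preserved m sb))))
... | tri> _ _ j′<j = Y≢ (drop-slice (yLength j) a′ b′
        (≤-trans (slotEnd-≤ (tier-≥5 m′)) (^-monoʳ-≤ 2 j′<j)) (SameReveal.after r′))
  where
  j = proj₁ (tier m)
  Y≢ : Y j a′ ≢ Y j b′
  Y≢ e = Y-differs (tier m) r a≢b (trans (Y-preserved m sa) (trans e (sym (Y-preserved m sb))))
... | tri≈ _ j≡j′ _ = same-tier
  where
  j = proj₁ (tier m)
  Y≢ : code (Y j a′) ≢ code (Y j b′)
  Y≢ e = Y-differs (tier m) r a≢b
           (trans (Y-preserved m sa) (trans (code-injective _ _ e) (sym (Y-preserved m sb))))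
  blend₁ : blend (tier m) a′ ≡ blend (tier m) b′
  blend₁ = trans (sym (blend-preserved m sa)) (trans (SameReveal.blends r) (blend-preserved m sb))
  blend₂ : blend (j , proj₂ (tier m′)) a′ ≡ blend (j , proj₂ (tier m′)) b′
  blend₂ = subst (λ i → blend (i , proj₂ (tier m′)) a′ ≡ blend (i , proj₂ (tier m′)) b′)
                 (sym j≡j′) (SameReveal.blends r′)
  same-tier : ⊥
  -- In one tier the same `y` and `z` are blended twice. Different slopes would determine `y`; equal
  -- slopes mean equal levels, which cannot follow each other.
  same-tier with <-cmp (proj₂ (tier m)) (proj₂ (tier m′))
  ... | tri< α<α′ _ _ = Y≢ (slope-unique (code (Z j a′)) (code (Z j b′)) _ _ α<α′ blend₁ blend₂)
  ... | tri> _ _ α′<α = Y≢ (slope-unique (code (Z j a′)) (code (Z j b′)) _ _ α′<α blend₂ blend₁)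
  ... | tri≈ _ α≡α′ _ with tier-injective m m′ (cong₂ _,_ j≡j′ α≡α′)
  ...   | refl = Split-no-repeat sa sa′

shortBits : ℕ → Bits → Bits → Bits
shortBits m letter w with tier m
... | t@(j , α) = unary j (bits (suc j) α ++ letter ++ take (yStart j) w ++
                           bits (3 * suc j + 2) (blend t w) ++ drop (slotEnd j) w)

length-slice-≤ : ∀ s l w → length (slice s l w) ≤ l
length-slice-≤ s l w = ≤-trans (≤-reflexive (length-take l (drop s w))) (m⊓n≤m l _)

-- `code` needs one bit more than its string. The lengths of `α` and `y` add up to that of `z`, so
-- both summands are bounded by `2 ^ (3 * suc j + 1)`.
blend-bound : ∀ j α w → α < 2 ^ suc j → blend (j , α) w < 2 ^ (3 * suc j + 2)
blend-bound j α w α< = begin-strict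
  code (Z j w) + α * code (Y j w)
    <⟨ +-mono-<-≤ (code-slice (zStart j) (zLength j)) (*-mono-≤ (<⇒≤ α<) (<⇒≤ (code-slice (yStart j) (yLength j)))) ⟩
  2 ^ suc (3 * suc j) + 2 ^ suc j * 2 ^ suc (2 * suc j)
    ≡⟨ cong (2 ^ suc (3 * suc j) +_) (trans (sym (^-distribˡ-+-* 2 (suc j) (suc (2 * suc j)))) (cong (2 ^_) (lemma j))) ⟩
  2 ^ suc (3 * suc j) + 2 ^ suc (3 * suc j)
    ≡⟨ cong (2 ^ suc (3 * suc j) +_) (sym (+-identityʳ _)) ⟩
  2 ^ suc (suc (3 * suc j))
    ≡⟨ cong (2 ^_) (+-comm 2 (3 * suc j)) ⟩
  2 ^ (3 * suc j + 2) ∎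
  where
  open ≤-Reasoning
  lemma : ∀ j → suc j + suc (2 * suc j) ≡ suc (3 * suc j)
  lemma = solve-∀
  code-slice : ∀ s l → code (slice s l w) < 2 ^ suc l
  code-slice s l = <-≤-trans (code-bound (slice s l w)) (^-monoʳ-≤ 2 (s≤s (length-slice-≤ s l w)))

-- The unary part reveals `j`, and `j` together with the lengths of the letter and the digits fixes
-- where every later part ends.
shortBits-injective : ∀ m m′ l l′ w w′ → length l ≡ length l′ → length w ≡ length w′ →
                      shortBits m l w ≡ shortBits m′ l′ w′ → m ≡ m′ × l ≡ l′ × SameReveal (tier m) w w′
shortBits-injective m m′ l l′ w w′ ll lw e with tier m in eq | tier m′ in eq′ | tier-< m | tier-< m′
... | j , α | j′ , α′ | α< | α′< with unary-injective j j′ e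
...   | refl , e₁ =
  let eα , e₂ = ++-injective (trans (length-bits (suc j) α) (sym (length-bits (suc j) α′))) e₁
      el , e₃ = ++-injective ll e₂
      eu , e₄ = ++-injective (trans (length-take (yStart j) w)
                  (trans (cong (yStart j ⊓_) lw) (sym (length-take (yStart j) w′)))) e₃
      et , ev = ++-injective (trans (length-bits (3 * suc j + 2) _) (sym (length-bits (3 * suc j + 2) _))) e₄
      α≡ = bits-injective (suc j) α< α′< eα
      t≡ = bits-injective (3 * suc j + 2) (blend-bound j α w α<) (blend-bound j α′ w′ α′<) et
  in tier-injective m m′ (trans eq (trans (cong (j ,_) α≡) (sym eq′))) , el ,
     reveal eu (trans t≡ (cong (λ β → blend (j , β) w′) (sym α≡))) ev

-- The fields `y` and `z` have `5 * suc j` digits. They are replaced by a blend of `3 * suc j + 2`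
-- digits and `2 * suc j` digits naming `j` and `α`: hiding `y` pays for showing the level.
length-shortBits : ∀ m l w → 64 + m ≤ length w → length (shortBits m l w) ≡ 2 + length l + length w
length-shortBits m l w h with tier m | slotEnd-≤-level m
... | t@(j , α) | end≤ = begin
  length (unary j _)        ≡⟨ length-unary j _ ⟩
  suc j + length (bits (suc j) α ++ l ++ u ++ b ++ v)
    ≡⟨ cong (suc j +_) (trans (length-++ (bits (suc j) α)) (cong₂ _+_ (length-bits (suc j) α)
         (trans (length-++ l) (cong (length l +_)
         (trans (length-++ u) (cong₂ _+_ length-u
         (trans (length-++ b) (cong₂ _+_ (length-bits (3 * suc j + 2) _) (length-drop (slotEnd j) w))))))))) ⟩
  suc j + (suc j + (length l + (yStart j + (3 * suc j + 2 + r))))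
    ≡⟨ lemma j (length l) (2 ^ j) r ⟩
  2 + length l + (2 ^ j + 2 * suc j + 3 * suc j + r)
    ≡⟨ cong (2 + length l +_) (m+[n∸m]≡n (≤-trans end≤ h)) ⟩
  2 + length l + length w   ∎
  where
  open ≡-Reasoning
  r = length w ∸ slotEnd j
  u = take (yStart j) w
  b = bits (3 * suc j + 2) (blend t w)
  v = drop (slotEnd j) w
  length-u : length u ≡ yStart j
  length-u = trans (length-take (yStart j) w)
    (m≤n⇒m⊓n≡m (≤-trans (≤-trans (m≤m+n _ (yLength j)) (m≤m+n _ (zLength j))) (≤-trans end≤ h)))
  lemma : ∀ j l P r → suc j + (suc j + (l + (P + (3 * suc j + 2 + r)))) ≡
          2 + l + (P + 2 * suc j + 3 * suc j + r)
  lemma = solve-∀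

-- The two words

_≟ⱽ_ : ∀ {m} → DecidableEquality (Vec Bool m)
_≟ⱽ_ = ≡-dec _≟ᵇ_

bools : List Bool
bools = false ∷ true ∷ []

∑-≟ⱽ : ∀ m (y : Vec Bool m) → ∑ (allVec bools m) (λ x → 𝟙 (does (x ≟ⱽ y))) ≡ 1
∑-≟ⱽ zero    []          = refl
∑-≟ⱽ (suc m) (false ∷ y) = trans (∑-allVec bools m _)
  (cong₂ _+_ (∑-≟ⱽ m y) (trans (+-identityʳ _) (trans (∑-const (allVec bools m) 0) (*-zeroʳ (length (allVec bools m))))))
∑-≟ⱽ (suc m) (true  ∷ y) = trans (∑-allVec bools m _)
  (cong₂ _+_ (trans (∑-const (allVec bools m) 0) (*-zeroʳ (length (allVec bools m))))
             (trans (+-identityʳ _) (∑-≟ⱽ m y)))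

≟ⱽ-sym : ∀ {m} (x y : Vec Bool m) → does (x ≟ⱽ y) ≡ does (y ≟ⱽ x)
≟ⱽ-sym x y with x ≟ⱽ y | y ≟ⱽ x
... | yes _ | yes _ = refl
... | no  _ | no  _ = refl
... | yes p | no  q = contradiction (sym p) q
... | no  p | yes q = contradiction (sym q) p

Letter : Set
Letter = Vec Bool 6

letters : List Letter
letters = allVec bools 6

agreement : ∀ {n} → Vec Letter n → Vec Letter n → Bits
agreement []       []       = []
agreement (x ∷ xs) (y ∷ ys) = does (x ≟ⱽ y) ∷ agreement xs ys

agreement-sym : ∀ {n} (x y : Vec Letter n) → agreement x y ≡ agreement y x
agreement-sym []       []       = refl
agreement-sym (x ∷ xs) (y ∷ ys) = cong₂ _∷_ (≟ⱽ-sym x y) (agreement-sym xs ys)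

agreement-True : ∀ d {n} (x y : Vec Letter n) {m} → m < n → at d x m ≡ at d y m → True m (agreement x y)
agreement-True d (x ∷ xs) (y ∷ ys) {zero}  m<n       e rewrite dec-true (x ≟ⱽ y) e = here
agreement-True d (x ∷ xs) (y ∷ ys) {suc m} (s≤s m<n) e = there (agreement-True d xs ys m<n e)

64^count-∷ : ∀ b bs → 64 ^ count (b ∷ bs) ≡ 64 ^ 𝟙 b * 64 ^ count bs
64^count-∷ true  bs = refl
64^count-∷ false bs = sym (+-identityʳ (64 ^ count bs))

-- Exponential moment: a place agrees with probability `1/64` and then weighs 64, so each place
-- contributes a factor below 2, and the places are independent.
∑-64^agreement : ∀ n (y : Vec Letter n) → ∑ (allVec letters n) (λ x → 64 ^ count (agreement x y)) ≤ (2 * 64) ^ n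
∑-64^agreement zero    []       = ≤-refl
∑-64^agreement (suc n) (y ∷ ys) = begin
  ∑ (allVec letters (suc n)) (λ x → 64 ^ count (agreement x (y ∷ ys)))
    ≡⟨ ∑-allVec letters n _ ⟩
  ∑ letters (λ x → ∑ W (λ xs → 64 ^ count (does (x ≟ⱽ y) ∷ agreement xs ys)))
    ≡⟨ ∑-cong letters (λ x → ∑-cong W (λ xs → 64^count-∷ (does (x ≟ⱽ y)) (agreement xs ys))) ⟩
  ∑ letters (λ x → ∑ W (λ xs → 64 ^ 𝟙 (does (x ≟ⱽ y)) * 64 ^ count (agreement xs ys)))
    ≡⟨ ∑-cong letters (λ x → ∑-distribˡ-* W (64 ^ 𝟙 (does (x ≟ⱽ y))) (λ xs → 64 ^ count (agreement xs ys))) ⟩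
  ∑ letters (λ x → 64 ^ 𝟙 (does (x ≟ⱽ y)) * S)
    ≡⟨ ∑-distribʳ-* letters S (λ x → 64 ^ 𝟙 (does (x ≟ⱽ y))) ⟩
  ∑ letters (λ x → 64 ^ 𝟙 (does (x ≟ⱽ y))) * S
    ≤⟨ *-mono-≤ one (∑-64^agreement n ys) ⟩
  2 * 64 * (2 * 64) ^ n ∎
  where
  open ≤-Reasoning
  W = allVec letters n
  S = ∑ W (λ xs → 64 ^ count (agreement xs ys))
  64^𝟙 : ∀ b → 64 ^ 𝟙 b ≤ 1 + 64 * 𝟙 b
  64^𝟙 true  = n≤1+n 64
  64^𝟙 false = ≤-refl
  one : ∑ letters (λ x → 64 ^ 𝟙 (does (x ≟ⱽ y))) ≤ 2 * 64
  one = begin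
    ∑ letters (λ x → 64 ^ 𝟙 (does (x ≟ⱽ y)))       ≤⟨ ∑-mono letters (λ x → 64^𝟙 (does (x ≟ⱽ y))) ⟩
    ∑ letters (λ x → 1 + 64 * 𝟙 (does (x ≟ⱽ y)))   ≡⟨ ∑-distrib-+ letters (λ _ → 1) (λ x → 64 * 𝟙 (does (x ≟ⱽ y))) ⟩
    ∑ letters (λ _ → 1) + ∑ letters (λ x → 64 * 𝟙 (does (x ≟ⱽ y)))
      ≡⟨ cong₂ _+_ (∑-const letters 1) (∑-distribˡ-* letters 64 (λ x → 𝟙 (does (x ≟ⱽ y)))) ⟩
    64 + 64 * ∑ letters (λ x → 𝟙 (does (x ≟ⱽ y)))   ≡⟨ cong (λ t → 64 + 64 * t) (∑-≟ⱽ 6 y) ⟩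
    2 * 64 ∎

similar : ∀ {n} → ℕ → Vec Letter n → Vec Letter n → Bool
similar h x y = does (h ≤? count (agreement x y))

similar-sym : ∀ {n} h (x y : Vec Letter n) → similar h x y ≡ similar h y x
similar-sym h x y = cong (λ t → does (h ≤? count t)) (agreement-sym x y)

-- Markov's inequality for the exponential moment.
similar-rare : ∀ n h (y : Vec Letter n) → 64 ^ h * ∑ (allVec letters n) (λ x → 𝟙 (similar h x y)) ≤ (2 * 64) ^ n
similar-rare n h y = begin
  64 ^ h * ∑ W (λ x → 𝟙 (similar h x y))      ≡⟨ sym (∑-distribˡ-* W (64 ^ h) (λ x → 𝟙 (similar h x y))) ⟩
  ∑ W (λ x → 64 ^ h * 𝟙 (similar h x y))      ≤⟨ ∑-mono W (λ x → threshold (h ≤? count (agreement x y))) ⟩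
  ∑ W (λ x → 64 ^ count (agreement x y))      ≤⟨ ∑-64^agreement n y ⟩
  (2 * 64) ^ n                                ∎
  where
  open ≤-Reasoning
  W = allVec letters n
  threshold : ∀ {c} (p : Dec (h ≤ c)) → 64 ^ h * 𝟙 (does p) ≤ 64 ^ c
  threshold (yes h≤c) = ≤-trans (≤-reflexive (*-identityʳ (64 ^ h))) (^-monoʳ-≤ 64 h≤c)
  threshold (no  _)   = ≤-trans (≤-reflexive (*-zeroʳ (64 ^ h))) z≤n

-- Two letters out of `2 ^ D` agree with probability `2 ^ (- D)`. With `g = 2 ^ (H + 1)` the
-- condition `32 * g * g ≤ 2 ^ D` is an equality, and `N / g` is the excluded length.
word₁-exists : ∀ H κ .{{_ : NonZero κ}} (d : Vec Bool (2 * H + 7)) N → N ≡ 2 ^ (2 * H + 6) * κ →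
  let open Chains d (λ x y → does (x ≟ⱽ y)) in
  ∃ λ (w : Vec (Vec Bool (2 * H + 7)) N) → ¬ Chain w (2 ^ (H + 5) * κ) N N
word₁-exists H κ d N N≡ = subst (λ N → ∃ λ (w : Vec (Vec Bool D) N) → ¬ Chain w n N N) N≡′
    (word-without-long-chain (2 ^ H) n bound)
  where
  D = 2 * H + 7
  n = 2 ^ (H + 5) * κ
  xs = allVec bools D
  length-xs : length xs ≡ 2 ^ D
  length-xs = length-allVec bools D
  instance
    n≢0 : NonZero n
    n≢0 = m*n≢0 _ κ {{m^n≢0 2 (H + 5)}}
    2^H≢0 : NonZero (2 ^ H)
    2^H≢0 = m^n≢0 2 H
    length≢0 : NonZero (length xs)
    length≢0 = subst NonZero (sym length-xs) (m^n≢0 2 D)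
  open Chains d (λ x y → does (x ≟ⱽ y))
  rare : ∀ y → 2 ^ D * ∑ xs (λ x → 𝟙 (does (x ≟ⱽ y))) ≤ length xs
  rare y = ≤-reflexive (trans (cong (2 ^ D *_) (∑-≟ⱽ D y)) (trans (*-identityʳ _) (sym length-xs)))
  rare′ : ∀ y → 2 ^ D * ∑ xs (λ x → 𝟙 (does (y ≟ⱽ x))) ≤ length xs
  rare′ y = ≤-trans (≤-reflexive (cong (2 ^ D *_) (∑-cong xs (λ x → cong 𝟙 (≟ⱽ-sym y x))))) (rare y)
  open Counting xs (2 ^ D) rare rare′
  lemma₁ : ∀ P → 32 * ((P + P) * (P + P)) ≡ P * (P * 128)
  lemma₁ = solve-∀
  lemma₂ : ∀ H → H + (H + 7) ≡ 2 * H + 7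
  lemma₂ = solve-∀
  bound : 32 * ((2 ^ H + 2 ^ H) * (2 ^ H + 2 ^ H)) ≤ 2 ^ D
  bound = ≤-reflexive (trans (lemma₁ (2 ^ H)) (trans (cong (2 ^ H *_) (sym (^-distribˡ-+-* 2 H 7)))
            (trans (sym (^-distribˡ-+-* 2 H (H + 7))) (cong (2 ^_) (lemma₂ H)))))
  lemma₃ : ∀ P K → (P + P) * K ≡ P * (2 * K)
  lemma₃ = solve-∀
  lemma₄ : ∀ H → H + suc (H + 5) ≡ 2 * H + 6
  lemma₄ = solve-∀
  N≡′ : (2 ^ H + 2 ^ H) * n ≡ N
  N≡′ = trans (lemma₃ (2 ^ H) n) (trans (cong (2 ^ H *_) (sym (*-assoc 2 (2 ^ (H + 5)) κ)))
          (trans (sym (*-assoc (2 ^ H) (2 ^ suc (H + 5)) κ))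
          (trans (cong (_* κ) (trans (sym (^-distribˡ-+-* 2 H (suc (H + 5)))) (cong (2 ^_) (lemma₄ H)))) (sym N≡))))

-- Similarity has probability at most `2 ^ D / 64 ^ (H + 4) = 2 ^ (- (4 * H + 17))`. This allows `g
-- = 2 ^ (2 * H + 6)`, so that already chains of `N / g = κ` pairs are excluded.
word₂-exists : ∀ H κ .{{_ : NonZero κ}} (d : Vec Letter (2 * H + 7)) N → N ≡ 2 ^ (2 * H + 6) * κ →
  let open Chains d (similar (H + 4)) in
  ∃ λ (w : Vec (Vec Letter (2 * H + 7)) N) → ¬ Chain w κ N N
word₂-exists H κ d N N≡ = subst (λ N → ∃ λ (w : Vec (Vec Letter D) N) → ¬ Chain w κ N N) N≡′
    (word-without-long-chain m κ bound)
  where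
  D = 2 * H + 7
  m = 2 ^ (2 * H + 5)
  Q = 2 ^ (4 * H + 17)
  xs = allVec letters D
  length-xs : length xs ≡ 64 ^ D
  length-xs = length-allVec letters D
  instance
    m≢0 : NonZero m
    m≢0 = m^n≢0 2 (2 * H + 5)
    length≢0 : NonZero (length xs)
    length≢0 = subst NonZero (sym length-xs) (m^n≢0 64 D)
    2^D≢0 : NonZero (2 ^ D)
    2^D≢0 = m^n≢0 2 D
  open Chains d (similar (H + 4))
  lemma₁ : ∀ H → 6 * (H + 4) ≡ 2 * H + 7 + (4 * H + 17)
  lemma₁ = solve-∀
  64^h : 64 ^ (H + 4) ≡ 2 ^ D * Q
  64^h = trans (^-*-assoc 2 6 (H + 4)) (trans (cong (2 ^_) (lemma₁ H)) (^-distribˡ-+-* 2 D (4 * H + 17)))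
  rare : ∀ y → Q * ∑ xs (λ x → 𝟙 (similar (H + 4) x y)) ≤ length xs
  rare y = *-cancelˡ-≤ (2 ^ D) (begin
    2 ^ D * (Q * S)        ≡⟨ sym (*-assoc (2 ^ D) Q S) ⟩
    2 ^ D * Q * S          ≡⟨ cong (_* S) (sym 64^h) ⟩
    64 ^ (H + 4) * S       ≤⟨ similar-rare D (H + 4) y ⟩
    (2 * 64) ^ D           ≡⟨ power-product 2 64 D ⟩
    2 ^ D * 64 ^ D         ≡⟨ cong (2 ^ D *_) (sym length-xs) ⟩
    2 ^ D * length xs      ∎)
    where
    open ≤-Reasoning
    S = ∑ xs (λ x → 𝟙 (similar (H + 4) x y))
  rare′ : ∀ y → Q * ∑ xs (λ x → 𝟙 (similar (H + 4) y x)) ≤ length xs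
  rare′ y = ≤-trans (≤-reflexive (cong (Q *_) (∑-cong xs (λ x → cong 𝟙 (similar-sym (H + 4) y x))))) (rare y)
  open Counting xs Q rare rare′
  lemma₂ : ∀ P → 32 * ((P + P) * (P + P)) ≡ P * (P * 128)
  lemma₂ = solve-∀
  lemma₃ : ∀ H → 2 * H + 5 + (2 * H + 5 + 7) ≡ 4 * H + 17
  lemma₃ = solve-∀
  bound : 32 * ((m + m) * (m + m)) ≤ Q
  bound = ≤-reflexive (trans (lemma₂ m) (trans (cong (m *_) (sym (^-distribˡ-+-* 2 (2 * H + 5) 7)))
            (trans (sym (^-distribˡ-+-* 2 (2 * H + 5) (2 * H + 5 + 7))) (cong (2 ^_) (lemma₃ H)))))
  lemma₄ : ∀ P → P + P ≡ P * 2
  lemma₄ = solve-∀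
  lemma₅ : ∀ H → 2 * H + 5 + 1 ≡ 2 * H + 6
  lemma₅ = solve-∀
  N≡′ : (m + m) * κ ≡ N
  N≡′ = trans (cong (_* κ) (trans (lemma₄ m) (trans (sym (^-distribˡ-+-* 2 (2 * H + 5) 1)) (cong (2 ^_) (lemma₅ H))))) (sym N≡)

-- The colouring, and the course of a twin

toList-inj : ∀ {A : Set} {n} (x y : Vec A n) → toList x ≡ toList y → x ≡ y
toList-inj []       []       e = refl
toList-inj (x ∷ xs) (y ∷ ys) refl-e with refl ← proj₁ (∷-injective refl-e) =
  cong (x ∷_) (toList-inj xs ys (proj₂ (∷-injective refl-e)))

true≢false : ∀ {xs ys : Bits} → true ∷ xs ≢ false ∷ ys
true≢false ()

masked-replicate-++ : ∀ n bs w {h} → count bs ≤ h → masked (replicate n true ++ bs) w < 2 ^ n * 2 ^ h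
masked-replicate-++ n bs w {h} c≤h = begin-strict
  masked (replicate n true ++ bs) w       <⟨ masked-bound (replicate n true ++ bs) w ⟩
  2 ^ count (replicate n true ++ bs)      ≡⟨ cong (2 ^_) (trans (count-++ (replicate n true) bs)
                                               (cong (_+ count bs) (count-replicate n))) ⟩
  2 ^ (n + count bs)                      ≤⟨ ^-monoʳ-≤ 2 (+-monoʳ-≤ n c≤h) ⟩
  2 ^ (n + h)                             ≡⟨ ^-distribˡ-+-* 2 n h ⟩
  2 ^ n * 2 ^ h                           ∎
  where open ≤-Reasoning

masked-replicate : ∀ n w → masked (replicate n true) w < 2 ^ n
masked-replicate n w = <-≤-trans (masked-bound (replicate n true) w) (≤-reflexive (cong (2 ^_) (count-replicate n)))

-- Abstract, so that the power is never unfolded.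
abstract
  2^64 : ℕ
  2^64 = 2 ^ 64

  2^64>0 : 0 < 2^64
  2^64>0 = m^n>0 2 64

  head-bound : ∀ w → masked (replicate 64 true) w < 2^64
  head-bound = masked-replicate 64

  masked-head-++ : ∀ bs w {h} → count bs ≤ h → masked (replicate 64 true ++ bs) w < 2^64 * 2 ^ h
  masked-head-++ = masked-replicate-++ 64

module Construction (D h N : ℕ) (w₁ : Vec (Vec Bool D) N) (w₂ : Vec (Vec Letter D) N) where

  d₀ : Letter
  d₀ = Vec.replicate 6 false

  d₁ : Vec Bool D
  d₁ = Vec.replicate D false

  d₂ : Vec Letter D
  d₂ = Vec.replicate D d₀

  instance
    2^D≢0 : NonZero (2 ^ D)
    2^D≢0 = m^n≢0 2 D

  block : ℕ → ℕ
  block i = i / 2 ^ D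

  digits : ℕ → Bits
  digits i = bits D (i % 2 ^ D)

  letter : ℕ → ℕ → Letter
  letter A m = at d₀ (at d₂ w₂ A) m

  length-digits : ∀ i → length (digits i) ≡ D
  length-digits i = length-bits D (i % 2 ^ D)

  vertex-injective : ∀ {i i′} → block i ≡ block i′ → digits i ≡ digits i′ → i ≡ i′
  vertex-injective {i} {i′} b e = begin
    i                                     ≡⟨ m≡m%n+[m/n]*n i (2 ^ D) ⟩
    i % 2 ^ D + block i * 2 ^ D           ≡⟨ cong₂ (λ o A → o + A * 2 ^ D)
                                               (bits-injective D (m%n<n i (2 ^ D)) (m%n<n i′ (2 ^ D)) e) b ⟩
    i′ % 2 ^ D + block i′ * 2 ^ D         ≡⟨ sym (m≡m%n+[m/n]*n i′ (2 ^ D)) ⟩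
    i′                                    ∎
    where open ≡-Reasoning

  -- The prefixes are tags: `false` for short, `true ∷ false` for medium and `true ∷ true` for long
  -- edges.
  colourIn : ℕ → ℕ → Bits → Bits
  colourIn A k w with k <? 64
  ... | yes _ = true ∷ false ∷ []
  ... | no  _ = false ∷ shortBits (k ∸ 64) (toList (letter A (k ∸ 64))) w

  colour : ℕ → ℕ → Bits
  colour i i′ with block i ≟ block i′
  ... | yes _ = colourIn (block i) (splitLevel (digits i) (digits i′)) (digits i)
  ... | no  _ = true ∷ true ∷ toList (at d₁ w₁ (block i))

  data Edge (i i′ : ℕ) : Set where
    long   : block i < block i′ → colour i i′ ≡ true ∷ true ∷ toList (at d₁ w₁ (block i)) → Edge i i′
    medium : block i ≡ block i′ → ∀ {k} → k < 64 → Split k (digits i) (digits i′) →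
             colour i i′ ≡ true ∷ false ∷ [] → Edge i i′
    short  : block i ≡ block i′ → ∀ m → Split (64 + m) (digits i) (digits i′) →
             colour i i′ ≡ false ∷ shortBits m (toList (letter (block i) m)) (digits i) → Edge i i′

  edge : ∀ {i i′} → i < i′ → Edge i i′
  edge {i} {i′} i<i′ with block i ≟ block i′ in eq
  ... | no  A≢ = long (≤∧≢⇒< (/-monoˡ-≤ (2 ^ D) (<⇒≤ i<i′)) A≢) (colour-≢ eq)
    where
    colour-≢ : ∀ {p} → (block i ≟ block i′) ≡ no p → colour i i′ ≡ true ∷ true ∷ toList (at d₁ w₁ (block i))
    colour-≢ e rewrite e = refl
  ... | yes A≡ with bits-split D {i % 2 ^ D} {i′ % 2 ^ D} o<o′ (m%n<n i′ (2 ^ D))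
    where
    o<o′ : i % 2 ^ D < i′ % 2 ^ D
    o<o′ = +-cancelʳ-< (block i * 2 ^ D) _ _ (subst₂ _<_ (m≡m%n+[m/n]*n i (2 ^ D))
             (trans (m≡m%n+[m/n]*n i′ (2 ^ D)) (cong (λ A → i′ % 2 ^ D + A * 2 ^ D) (sym A≡))) i<i′)
  ...   | k , s with k <? 64 in eqk
  ...     | yes k<64 = medium A≡ k<64 s colour-≡
    where
    colour-≡ : colour i i′ ≡ true ∷ false ∷ []
    colour-≡ rewrite eq | Split⇒splitLevel s | eqk = refl
  ...     | no  k≮64 = short A≡ (k ∸ 64) (subst (λ k → Split k (digits i) (digits i′)) (sym (m+[n∸m]≡n (≮⇒≥ k≮64))) s) colour-≡
    where
    colour-≡ : colour i i′ ≡ false ∷ shortBits (k ∸ 64) (toList (letter (block i) (k ∸ 64))) (digits i)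
    colour-≡ rewrite eq | Split⇒splitLevel s | eqk = refl

  -- The maximum comes from short edges: one digit of tag, six of the letter and `2 + D` for the
  -- rest.
  length-colour : ∀ {i i′} → i < i′ → length (colour i i′) ≤ 9 + D
  length-colour {i} {i′} i<i′ with edge i<i′
  ... | long   _ e      rewrite e | length-toList (at d₁ w₁ (block i)) = m≤n+m (2 + D) 7
  ... | medium _ _ _ e  rewrite e = m≤m+n 2 (7 + D)
  ... | short  _ m s e  rewrite e = ≤-reflexive (cong suc (trans
          (length-shortBits m (toList (letter (block i) m)) (digits i) (<⇒≤ (Split⇒<length s)))
          (cong₂ (λ l k → 2 + l + k) (length-toList (letter (block i) m)) (length-digits i))))

  data Step (a b a′ b′ : ℕ) : Set where
    long   : block a < block a′ → block b < block b′ →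
             at d₁ w₁ (block a) ≡ at d₁ w₁ (block b) → Step a b a′ b′
    medium : block a ≡ block a′ → block b ≡ block b′ →
             ∀ {k} → k < 64 → Split k (digits a) (digits a′) → Step a b a′ b′
    short  : block a ≡ block a′ → block b ≡ block b′ →
             ∀ m → Split (64 + m) (digits a) (digits a′) → Split (64 + m) (digits b) (digits b′) →
             letter (block a) m ≡ letter (block b) m →
             SameReveal (tier m) (digits a) (digits b) → Step a b a′ b′

  step : ∀ {a b a′ b′} → a < a′ → b < b′ → colour a a′ ≡ colour b b′ → Step a b a′ b′
  step {a} {b} a< b< e with edge a< | edge b<
  ... | long A< ca | long B< cb =
    long A< B< (toList-inj _ _ (proj₂ (∷-injective (proj₂ (∷-injective (trans (sym ca) (trans e cb)))))))
  ... | medium A≡ k< s ca | medium B≡ _ _ cb = medium A≡ B≡ k< s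
  ... | short A≡ m s ca | short B≡ m′ s′ cb with
          shortBits-injective m m′ (toList (letter (block a) m)) (toList (letter (block b) m′)) (digits a) (digits b)
            (trans (length-toList (letter (block a) m)) (sym (length-toList (letter (block b) m′))))
            (trans (length-digits a) (sym (length-digits b)))
            (proj₂ (∷-injective (trans (sym ca) (trans e cb))))
  ...   | refl , l≡ , r = short A≡ B≡ m s s′ (toList-inj _ _ l≡) r
  step {a} {b} a< b< e | long A< ca | medium B≡ k< s cb with trans (sym ca) (trans e cb)
  ... | ()
  step {a} {b} a< b< e | medium A≡ k< s ca | long B< cb with trans (sym ca) (trans e cb)
  ... | ()
  step {a} {b} a< b< e | short A≡ m s ca | long B< cb = contradiction (trans (sym cb) (trans (sym e) ca)) true≢false
  step {a} {b} a< b< e | short A≡ m s ca | medium B≡ k< s′ cb = contradiction (trans (sym cb) (trans (sym e) ca)) true≢false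
  step {a} {b} a< b< e | long A< ca | short B≡ m s cb = contradiction (trans (sym ca) (trans e cb)) true≢false
  step {a} {b} a< b< e | medium A≡ k< s′ ca | short B≡ m s cb = contradiction (trans (sym ca) (trans e cb)) true≢false

  open Chains d₁ (λ x y → does (x ≟ⱽ y)) using () renaming
    (Chain to Chain₁; [] to []₁; add to add₁; weaken to weaken₁) public
  open Chains d₂ (similar h) using () renaming
    (Chain to Chain₂; [] to []₂; add to add₂; weaken to weaken₂) public

  -- The levels at which a twin can move inside two different blocks; if the words are similar, the
  -- trivial bound by all levels is good enough, because that is rare.
  maskFor : ∀ (x y : Vec Letter D) → Dec (h ≤ count (agreement x y)) → Bits
  maskFor x y (yes _) = replicate D true
  maskFor x y (no  _) = replicate 64 true ++ agreement x y

  mask : ℕ → ℕ → Bits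
  mask A B = maskFor x y (h ≤? count (agreement x y))
    where
    x = at d₂ w₂ A
    y = at d₂ w₂ B

  mask-medium : ∀ A B {k} → k < D → k < 64 → True k (mask A B)
  mask-medium A B k<D k<64 with h ≤? count (agreement (at d₂ w₂ A) (at d₂ w₂ B))
  ... | yes _ = True-replicate k<D
  ... | no  _ = True-++ˡ _ (True-replicate k<64)

  mask-short : ∀ A B {m} → 64 + m < D → letter A m ≡ letter B m → True (64 + m) (mask A B)
  mask-short A B {m} k<D l with h ≤? count (agreement (at d₂ w₂ A) (at d₂ w₂ B))
  ... | yes _ = True-replicate k<D
  ... | no  _ = True-++ʳ (replicate 64 true)
                  (agreement-True d₀ (at d₂ w₂ A) (at d₂ w₂ B) (≤-<-trans (m≤n+m m 64) k<D) l)

  -- Bounds for the steps inside a pair of different blocks: `cap₁` when fewer than `h` letters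
  -- agree, `cap₂` in the rare case that at least `h` do.
  cap₁ cap₂ : ℕ
  cap₁ = 2^64 * 2 ^ h
  cap₂ = 2 ^ D

  -- In different blocks it rises with every short step, so it pays for the short steps made since
  -- the present pair of blocks was entered.
  potentialFor : ∀ {A B} → Dec (A ≡ B) → Bits → ℕ
  potentialFor         (yes _) w = 0
  potentialFor {A} {B} (no  _) w = masked (mask A B) w

  potential : ℕ → ℕ → ℕ
  potential a b = potentialFor (block a ≟ block b) (digits a)

  potential-far : ∀ {a b} → block a ≢ block b → potential a b ≡ masked (mask (block a) (block b)) (digits a)
  potential-far {a} {b} A≢B with block a ≟ block b
  ... | yes A≡B = contradiction A≡B A≢B
  ... | no  _   = refl

  potential-near : ∀ {a b} → block a ≡ block b → potential a b ≡ 0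
  potential-near {a} {b} A≡B with block a ≟ block b
  ... | yes _   = refl
  ... | no  A≢B = contradiction A≡B A≢B

  far-bound : ∀ A B w → masked (mask A B) w < cap₁ ⊎
                        (similar h (at d₂ w₂ A) (at d₂ w₂ B) ≡ true × masked (mask A B) w < cap₂)
  far-bound A B w with h ≤? count (agreement (at d₂ w₂ A) (at d₂ w₂ B))
  ... | yes h≤ = inj₂ (dec-true (h ≤? _) h≤ , masked-replicate D w)
  ... | no  h≰ = inj₁ (masked-head-++ _ w (<⇒≤ (≰⇒> h≰)))

  -- Block number and first 64 digits as one number. It rises with long and medium steps and is
  -- constant under short ones, so it bounds `coarse`.
  height : ℕ → ℕ
  height a = block a * 2^64 + masked (replicate 64 true) (digits a)

  height-bound : ∀ a → height a < suc (block a) * 2^64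
  height-bound a = <-≤-trans (+-monoʳ-< (block a * 2^64) (head-bound (digits a)))
                     (≤-reflexive (+-comm (block a * 2^64) (2^64)))

  height-long : ∀ {a a′} → block a < block a′ → height a < height a′
  height-long {a} {a′} A< = <-≤-trans (height-bound a) (≤-trans (*-monoˡ-≤ (2^64) A<) (m≤m+n _ _))

  height-short : ∀ {a a′} → block a ≡ block a′ → ∀ m → Split (64 + m) (digits a) (digits a′) →
                 height a ≡ height a′
  height-short A≡ m s = cong₂ (λ A p → A * 2^64 + p) A≡ (masked-≡ (replicate 64 true) s
    (≤-trans (≤-reflexive (length-replicate 64 {x = true})) (m≤m+n 64 m)))

  -- No short step can follow. By `no-two-steps` this holds right after a short step in a common
  -- block, so a long or medium step must come before the next short one.
  Blocked : ℕ → ℕ → Set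
  Blocked a b = ∀ m {w} → SameReveal (tier m) (digits a) (digits b) → ¬ Split (64 + m) (digits a) w

  -- After t steps at (a , b): coarse counts the long and medium steps, near and far the short ones
  -- inside a common block and inside different blocks; the chains consist of the pairs of
  -- different blocks that have been left.
  record Inv (t a b : ℕ) : Set where
    field
      coarse near far v₁ v₂ : ℕ
      time   : t ≤ coarse + near + far
      coarse≤ : coarse ≤ height a
      near≤  : near ≤ coarse ⊎ (near ≤ suc coarse × Blocked a b)
      chain₁ : Chain₁ w₁ v₁ (block a) (block b)
      chain₂ : Chain₂ w₂ v₂ (block a) (block b)
      far≤   : far ≤ v₁ * cap₁ + v₂ * cap₂ + potential a b

  start : ∀ a b → Inv 0 a b
  start a b = record
    { coarse = 0 ; near = 0 ; far = 0 ; v₁ = 0 ; v₂ = 0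
    ; time = z≤n ; coarse≤ = z≤n ; near≤ = inj₁ z≤n ; chain₁ = []₁ ; chain₂ = []₂ ; far≤ = z≤n }

  near≤suc : ∀ {n c} {P : Set} → n ≤ c ⊎ (n ≤ suc c × P) → n ≤ suc c
  near≤suc (inj₁ n≤)       = m≤n⇒m≤1+n n≤
  near≤suc (inj₂ (n≤ , _)) = n≤

  -- When a pair of different blocks is left, it joins `chain₁` or `chain₂` according to similarity,
  -- and one more `cap₁` or `cap₂` takes over its potential.
  long-step : ∀ {t a b a′ b′} → block a < block a′ → block b < block b′ →
              at d₁ w₁ (block a) ≡ at d₁ w₁ (block b) → Inv t a b → Inv (suc t) a′ b′
  long-step {t} {a} {b} {a′} {b′} A< B< e I with block a ≟ block b
  ... | yes A≡B = record
    { coarse = suc coarse ; near = near ; far = far ; v₁ = v₁ ; v₂ = v₂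
    ; time = s≤s time ; coarse≤ = ≤-<-trans coarse≤ (height-long A<) ; near≤ = inj₁ (near≤suc near≤)
    ; chain₁ = weaken₁ (<⇒≤ A<) (<⇒≤ B<) chain₁ ; chain₂ = weaken₂ (<⇒≤ A<) (<⇒≤ B<) chain₂
    ; far≤ = ≤-trans far≤ (+-monoʳ-≤ (v₁ * cap₁ + v₂ * cap₂) (≤-trans (≤-reflexive (potential-near A≡B)) z≤n)) }
    where open Inv I
  ... | no A≢B with far-bound (block a) (block b) (digits a)
  ...   | inj₁ p< = record
    { coarse = suc coarse ; near = near ; far = far ; v₁ = suc v₁ ; v₂ = v₂
    ; time = s≤s time ; coarse≤ = ≤-<-trans coarse≤ (height-long A<) ; near≤ = inj₁ (near≤suc near≤)
    ; chain₁ = add₁ A< B< A≢B (dec-true (_ ≟ⱽ _) e) chain₁ ; chain₂ = weaken₂ (<⇒≤ A<) (<⇒≤ B<) chain₂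
    ; far≤ = begin
        far                                            ≤⟨ far≤ ⟩
        v₁ * cap₁ + v₂ * cap₂ + potential a b          ≤⟨ +-monoʳ-≤ (v₁ * cap₁ + v₂ * cap₂)
                                                            (≤-trans (≤-reflexive (potential-far A≢B)) (<⇒≤ p<)) ⟩
        v₁ * cap₁ + v₂ * cap₂ + cap₁                   ≡⟨ lemma v₁ v₂ cap₁ cap₂ ⟩
        suc v₁ * cap₁ + v₂ * cap₂                      ≤⟨ m≤m+n _ _ ⟩
        suc v₁ * cap₁ + v₂ * cap₂ + potential a′ b′    ∎ }
    where
    open Inv I
    open ≤-Reasoning
    lemma : ∀ v₁ v₂ c₁ c₂ → v₁ * c₁ + v₂ * c₂ + c₁ ≡ suc v₁ * c₁ + v₂ * c₂
    lemma = solve-∀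
  ...   | inj₂ (sim , p<) = record
    { coarse = suc coarse ; near = near ; far = far ; v₁ = v₁ ; v₂ = suc v₂
    ; time = s≤s time ; coarse≤ = ≤-<-trans coarse≤ (height-long A<) ; near≤ = inj₁ (near≤suc near≤)
    ; chain₁ = weaken₁ (<⇒≤ A<) (<⇒≤ B<) chain₁ ; chain₂ = add₂ A< B< A≢B sim chain₂
    ; far≤ = begin
        far                                            ≤⟨ far≤ ⟩
        v₁ * cap₁ + v₂ * cap₂ + potential a b          ≤⟨ +-monoʳ-≤ (v₁ * cap₁ + v₂ * cap₂)
                                                            (≤-trans (≤-reflexive (potential-far A≢B)) (<⇒≤ p<)) ⟩
        v₁ * cap₁ + v₂ * cap₂ + cap₂                   ≡⟨ lemma v₁ v₂ cap₁ cap₂ ⟩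
        v₁ * cap₁ + suc v₂ * cap₂                      ≤⟨ m≤m+n _ _ ⟩
        v₁ * cap₁ + suc v₂ * cap₂ + potential a′ b′    ∎ }
    where
    open Inv I
    open ≤-Reasoning
    lemma : ∀ v₁ v₂ c₁ c₂ → v₁ * c₁ + v₂ * c₂ + c₂ ≡ v₁ * c₁ + suc v₂ * c₂
    lemma = solve-∀

  potential-mono : ∀ {a b a′ b′ k} → block a ≡ block a′ → block b ≡ block b′ →
                   Split k (digits a) (digits a′) → True k (mask (block a) (block b)) →
                   potential a b ≤ potential a′ b′
  potential-mono {a} {b} {a′} {b′} A≡ B≡ s t with block a ≟ block b
  ... | yes _   = z≤n
  ... | no  A≢B = ≤-trans (<⇒≤ (masked-< s t)) (≤-reflexive (sym (trans
                    (potential-far (λ e → A≢B (trans A≡ (trans e (sym B≡)))))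
                    (cong₂ (λ A B → masked (mask A B) (digits a′)) (sym A≡) (sym B≡)))))

  medium-step : ∀ {t a b a′ b′ k} → block a ≡ block a′ → block b ≡ block b′ →
                k < 64 → Split k (digits a) (digits a′) → Inv t a b → Inv (suc t) a′ b′
  medium-step {t} {a} {b} {a′} {b′} A≡ B≡ k< s I = record
    { coarse = suc coarse ; near = near ; far = far ; v₁ = v₁ ; v₂ = v₂
    ; time = s≤s time
    ; coarse≤ = ≤-<-trans coarse≤ (subst (λ A → height a < A * 2^64 + masked (replicate 64 true) (digits a′)) A≡
        (+-monoʳ-< (block a * 2^64) (masked-< s (True-replicate k<))))
    ; near≤ = inj₁ (near≤suc near≤)
    ; chain₁ = weaken₁ (≤-reflexive A≡) (≤-reflexive B≡) chain₁
    ; chain₂ = weaken₂ (≤-reflexive A≡) (≤-reflexive B≡) chain₂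
    ; far≤ = ≤-trans far≤ (+-monoʳ-≤ (v₁ * cap₁ + v₂ * cap₂) (potential-mono {a} {b} A≡ B≡ s
        (mask-medium (block a) (block b) (subst (_ <_) (length-digits a) (Split⇒<length s)) k<))) }
    where open Inv I

  -- A blocked pair admits no such step. In a common block the step is counted by `near` and leaves
  -- a blocked pair; in different blocks the equal letters mark the level, so the potential pays for
  -- it.
  short-step : ∀ {t a b a′ b′} → a ≢ b → block a ≡ block a′ → block b ≡ block b′ →
               ∀ m → Split (64 + m) (digits a) (digits a′) → Split (64 + m) (digits b) (digits b′) →
               letter (block a) m ≡ letter (block b) m →
               SameReveal (tier m) (digits a) (digits b) → Inv t a b → Inv (suc t) a′ b′
  short-step {t} {a} {b} {a′} {b′} a≢b A≡ B≡ m s s′ l r I with Inv.near≤ I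
  ... | inj₂ (_ , blocked) = contradiction s (blocked m r)
  ... | inj₁ n≤c with block a ≟ block b
  ...   | yes A≡B = record
    { coarse = coarse ; near = suc near ; far = far ; v₁ = v₁ ; v₂ = v₂
    ; time = ≤-trans (s≤s time) (≤-reflexive (cong (_+ far) (sym (+-suc coarse near))))
    ; coarse≤ = ≤-trans coarse≤ (≤-reflexive (height-short A≡ m s))
    ; near≤ = inj₂ (s≤s n≤c , λ m′ r′ → no-two-steps m m′ r (λ e → a≢b (vertex-injective A≡B e)) s s′ r′)
    ; chain₁ = weaken₁ (≤-reflexive A≡) (≤-reflexive B≡) chain₁
    ; chain₂ = weaken₂ (≤-reflexive A≡) (≤-reflexive B≡) chain₂
    ; far≤ = ≤-trans far≤ (+-monoʳ-≤ (v₁ * cap₁ + v₂ * cap₂) (≤-trans (≤-reflexive (potential-near A≡B)) z≤n)) }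
    where
    open Inv I
  ...   | no A≢B = record
    { coarse = coarse ; near = near ; far = suc far ; v₁ = v₁ ; v₂ = v₂
    ; time = ≤-trans (s≤s time) (≤-reflexive (sym (+-suc (coarse + near) far)))
    ; coarse≤ = ≤-trans coarse≤ (≤-reflexive (height-short A≡ m s))
    ; near≤ = inj₁ n≤c
    ; chain₁ = weaken₁ (≤-reflexive A≡) (≤-reflexive B≡) chain₁
    ; chain₂ = weaken₂ (≤-reflexive A≡) (≤-reflexive B≡) chain₂
    ; far≤ = ≤-<-trans far≤ (+-monoʳ-< (v₁ * cap₁ + v₂ * cap₂) potential-<) }
    where
    open Inv I
    potential-< : potential a b < potential a′ b′
    potential-< = subst₂ _<_ (sym (potential-far A≢B)) (sym (trans
                    (potential-far (λ e → A≢B (trans A≡ (trans e (sym B≡)))))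
                    (cong₂ (λ A B → masked (mask A B) (digits a′)) (sym A≡) (sym B≡))))
                    (masked-< s (mask-short (block a) (block b) (subst (_ <_) (length-digits a) (Split⇒<length s)) l))

  advance : ∀ {t a b a′ b′} → a ≢ b → Step a b a′ b′ → Inv t a b → Inv (suc t) a′ b′
  advance a≢b (long A< B< e)         = long-step A< B< e
  advance a≢b (medium A≡ B≡ k< s)    = medium-step A≡ B≡ k< s
  advance a≢b (short A≡ B≡ m s s′ l r) = short-step a≢b A≡ B≡ m s s′ l r

  -- Here `t` counts steps, so each path has `suc t` vertices. The factor 2 comes from `near`
  -- exceeding `coarse` by at most 1.
  length-bound : ∀ {n₁ n₂ t a b} → ¬ Chain₁ w₁ n₁ N N → ¬ Chain₂ w₂ n₂ N N →
                 block a < N → block b < N → Inv t a b →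
                 suc t ≤ 2 * (N * 2^64) + (n₁ * cap₁ + n₂ * cap₂)
  length-bound {n₁} {n₂} {t} {a} {b} none₁ none₂ A< B< I = begin
    suc t                                             ≤⟨ s≤s time ⟩
    suc (coarse + near + far)                         ≤⟨ s≤s (+-mono-≤ (+-monoʳ-≤ coarse (near≤suc near≤)) far≤′) ⟩
    suc (coarse + suc coarse + (n₁ * cap₁ + n₂ * cap₂)) ≡⟨ lemma coarse (n₁ * cap₁ + n₂ * cap₂) ⟩
    2 * suc coarse + (n₁ * cap₁ + n₂ * cap₂)          ≤⟨ +-monoˡ-≤ (n₁ * cap₁ + n₂ * cap₂) (*-monoʳ-≤ 2 coarse<) ⟩
    2 * (N * 2^64) + (n₁ * cap₁ + n₂ * cap₂)        ∎
    where
    open Inv I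
    open ≤-Reasoning
    lemma : ∀ c f → suc (c + suc c + f) ≡ 2 * suc c + f
    lemma = solve-∀
    coarse< : coarse < N * 2^64
    coarse< = ≤-<-trans coarse≤ (<-≤-trans (height-bound a) (*-monoˡ-≤ (2^64) A<))
    v₁< : v₁ < n₁
    v₁< = ≰⇒> λ n₁≤ → none₁ (Chains.shorten d₁ _ n₁≤ (weaken₁ (<⇒≤ A<) (<⇒≤ B<) chain₁))
    v₂< : v₂ < n₂
    v₂< = ≰⇒> λ n₂≤ → none₂ (Chains.shorten d₂ _ n₂≤ (weaken₂ (<⇒≤ A<) (<⇒≤ B<) chain₂))
    lemma₁ : ∀ v₁ v₂ c₁ c₂ → v₁ * c₁ + v₂ * c₂ + c₁ ≡ suc v₁ * c₁ + v₂ * c₂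
    lemma₁ = solve-∀
    lemma₂ : ∀ v₁ v₂ c₁ c₂ → v₁ * c₁ + v₂ * c₂ + c₂ ≡ v₁ * c₁ + suc v₂ * c₂
    lemma₂ = solve-∀
    potential-bound : potential a b ≤ cap₁ ⊎ potential a b ≤ cap₂
    potential-bound with block a ≟ block b
    ... | yes _ = inj₁ z≤n
    ... | no  _ with far-bound (block a) (block b) (digits a)
    ...   | inj₁ p<       = inj₁ (<⇒≤ p<)
    ...   | inj₂ (_ , p<) = inj₂ (<⇒≤ p<)
    -- The pair of blocks still occupied is in no chain yet; the strict inequalities `v₁ < n₁` and
    -- `v₂ < n₂` leave a cap for it.
    far≤′ : far ≤ n₁ * cap₁ + n₂ * cap₂
    far≤′ with potential-bound
    ... | inj₁ p≤ = ≤-trans far≤ (≤-trans (+-monoʳ-≤ (v₁ * cap₁ + v₂ * cap₂) p≤)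
            (≤-trans (≤-reflexive (lemma₁ v₁ v₂ cap₁ cap₂)) (+-mono-≤ (*-monoˡ-≤ cap₁ v₁<) (*-monoˡ-≤ cap₂ (<⇒≤ v₂<)))))
    ... | inj₂ p≤ = ≤-trans far≤ (≤-trans (+-monoʳ-≤ (v₁ * cap₁ + v₂ * cap₂) p≤)
            (≤-trans (≤-reflexive (lemma₂ v₁ v₂ cap₁ cap₂)) (+-mono-≤ (*-monoˡ-≤ cap₁ (<⇒≤ v₁<)) (*-monoˡ-≤ cap₂ v₂<))))

-- Choice of the parameters

clamp : ∀ r .{{_ : NonZero r}} → ℕ → Fin r
clamp (suc r) x with x <? suc r
... | yes x<r = fromℕ< x<r
... | no  _   = Fin.zero

clamp-injective : ∀ r .{{_ : NonZero r}} {x y} → x < r → y < r → clamp r x ≡ clamp r y → x ≡ y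
clamp-injective (suc r) {x} {y} x<r y<r e with x <? suc r | y <? suc r
... | yes p | yes q = Fin.fromℕ<-injective x y p q e
... | no  p | _     = contradiction x<r p
... | _     | no  q = contradiction y<r q

twin-size-≤ : ∀ {n r ℓ} {c : Colouring n r} → Twin c ℓ → ℓ ≤ n
twin-size-≤ {ℓ = ℓ} τ = Fin.injective⇒≤ injective
  where
  open Twin τ
  injective : ∀ {s t : Fin ℓ} → I s ≡ I t → s ≡ t
  injective {s} {t} e with Fin.<-cmp s t
  ... | tri< s<t _ _ = contradiction (cong toℕ e) (<⇒≢ (I-incr s t s<t))
  ... | tri≈ _ s≡t _ = s≡t
  ... | tri> _ _ t<s = contradiction (cong toℕ (sym e)) (<⇒≢ (I-incr t s t<s))

-- `H` enters the exponents as `2 * H`, hence steps by a factor 4. The lower bound is `2 ^ (10 + D)`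
-- with `D = 2 * H + 7`, which exceeds all codes of colours of edges.
scale : ∀ r → r < 2 ^ 17 ⊎ ∃ λ H → 2 ^ (2 * H + 17) ≤ r × r < 2 ^ (2 * H + 19)
scale zero    = inj₁ (m^n>0 2 17)
scale (suc r) with scale r
... | inj₁ r< with suc r <? 2 ^ 17
...   | yes p = inj₁ p
...   | no  p = inj₂ (0 , ≮⇒≥ p , ≤-<-trans r< (^-monoʳ-< 2 ≤-refl (m<m+n 17 {2} (s≤s z≤n))))
scale (suc r) | inj₂ (H , lo , hi) with suc r <? 2 ^ (2 * H + 19)
... | yes p = inj₂ (H , m≤n⇒m≤1+n lo , p)
... | no  p = inj₂ (suc H , subst (λ e → 2 ^ e ≤ suc r) (lemma H) (≮⇒≥ p) ,
                    ≤-<-trans hi (^-monoʳ-< 2 ≤-refl (subst (2 * H + 19 <_) (lemma′ H) (m<m+n (2 * H + 19) {2} (s≤s z≤n)))))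
  where
  lemma : ∀ H → 2 * H + 19 ≡ 2 * suc H + 17
  lemma = solve-∀
  lemma′ : ∀ H → 2 * H + 19 + 2 ≡ 2 * suc H + 19
  lemma′ = solve-∀

module Large (H κ n r : ℕ) .{{_ : NonZero κ}} .{{_ : NonZero r}} (r≥ : 2 ^ (2 * H + 17) ≤ r)
             (n≤ : n ≤ 2 ^ (2 * H + 6) * κ * 2 ^ (2 * H + 7)) where

  D N n₁ : ℕ
  D  = 2 * H + 7
  N  = 2 ^ (2 * H + 6) * κ
  n₁ = 2 ^ (H + 5) * κ

  exists₁ = word₁-exists H κ (Vec.replicate D false) N refl
  exists₂ = word₂-exists H κ (Vec.replicate D (Vec.replicate 6 false)) N refl

  open Construction D (H + 4) N (proj₁ exists₁) (proj₁ exists₂)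

  colouring : Colouring n r
  colouring i i′ = clamp r (code (colour (toℕ i) (toℕ i′)))

  code< : ∀ {i i′} → i < i′ → code (colour i i′) < r
  code< {i} {i′} i<i′ = <-≤-trans (code-bound (colour i i′)) (≤-trans (^-monoʳ-≤ 2 (s≤s (length-colour i<i′)))
                 (≤-trans (≤-reflexive (cong (2 ^_) (lemma H))) r≥))
    where
    lemma : ∀ H → 10 + (2 * H + 7) ≡ 2 * H + 17
    lemma = solve-∀

  block< : (i : Fin n) → block (toℕ i) < N
  block< i = m<n*o⇒m/o<n (<-≤-trans (Fin.toℕ<n i) n≤)

  twin-bound : ∀ ℓ → Twin colouring ℓ → ℓ ≤ 2 * (N * 2^64) + (n₁ * cap₁ + κ * cap₂)
  twin-bound zero    τ = z≤n
  twin-bound (suc t) τ = length-bound (proj₂ exists₁) (proj₂ exists₂) (block< (I last)) (block< (J last)) (run t ≤-refl)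
    where
    open Twin τ
    last : Fin (suc t)
    last = fromℕ< {t} ≤-refl
    run : ∀ s (p : s < suc t) → Inv s (toℕ (I (fromℕ< p))) (toℕ (J (fromℕ< p)))
    run zero    p = start _ _
    run (suc s) p = advance (λ e → disjoint x x (Fin.toℕ-injective e))
        (step (I-incr x y x<y) (J-incr x y x<y)
          (code-injective (colour (toℕ (I x)) (toℕ (I y))) (colour (toℕ (J x)) (toℕ (J y))) (clamp-injective r (code< (I-incr x y x<y)) (code< (J-incr x y x<y))
            (colours x y y≡1+x))))
        (run s q)
      where
      q = <-trans (n<1+n s) p
      x y : Fin (suc t)
      x = fromℕ< q
      y = fromℕ< p
      y≡1+x : toℕ y ≡ suc (toℕ x)
      y≡1+x = trans (Fin.toℕ-fromℕ< p) (cong suc (sym (Fin.toℕ-fromℕ< q)))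
      x<y : x Fin.< y
      x<y = ≤-reflexive (sym y≡1+x)

  -- The parameters balance: `n₁ * cap₁ = 8 * N * 2^64` and `κ * cap₂ = 2 * N`, so every
  -- contribution is of order `N`.
  twin-bound′ : ∀ ℓ → Twin colouring ℓ → ℓ ≤ 2^64 * (12 * N)
  twin-bound′ ℓ τ = begin
    ℓ                                                     ≤⟨ twin-bound ℓ τ ⟩
    2 * (N * 2^64) + (n₁ * cap₁ + κ * cap₂)               ≡⟨ cong (2 * (N * 2^64) +_) (cong₂ _+_ e₁ e₂) ⟩
    2 * (N * 2^64) + (8 * N * 2^64 + 2 * N)               ≤⟨ +-monoʳ-≤ (2 * (N * 2^64)) (+-monoʳ-≤ (8 * N * 2^64)
                                                               (m≤m*n (2 * N) 2^64 {{>-nonZero 2^64>0}})) ⟩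
    2 * (N * 2^64) + (8 * N * 2^64 + 2 * N * 2^64)        ≡⟨ lemma₃ N 2^64 ⟩
    2^64 * (12 * N)                                       ∎
    where
    open ≤-Reasoning
    lemma₀ : ∀ H → H + 5 + (H + 4) ≡ 3 + (2 * H + 6)
    lemma₀ = solve-∀
    lemma₁ : ∀ P κ T Q → P * κ * (T * Q) ≡ P * Q * κ * T
    lemma₁ = solve-∀
    lemma₂ : ∀ P κ → κ * (2 * P) ≡ 2 * (P * κ)
    lemma₂ = solve-∀
    lemma₃ : ∀ N T → 2 * (N * T) + (8 * N * T + 2 * N * T) ≡ T * (12 * N)
    lemma₃ = solve-∀
    lemma₄ : ∀ H → 2 * H + 7 ≡ 1 + (2 * H + 6)
    lemma₄ = solve-∀
    e₁ : n₁ * cap₁ ≡ 8 * N * 2^64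
    e₁ = trans (lemma₁ (2 ^ (H + 5)) κ 2^64 (2 ^ (H + 4))) (cong (_* 2^64)
           (trans (cong (_* κ) (trans (sym (^-distribˡ-+-* 2 (H + 5) (H + 4)))
             (trans (cong (2 ^_) (lemma₀ H)) (^-distribˡ-+-* 2 3 (2 * H + 6)))))
             (*-assoc 8 (2 ^ (2 * H + 6)) κ)))
    e₂ : κ * cap₂ ≡ 2 * N
    e₂ = trans (cong (λ e → κ * 2 ^ e) (lemma₄ H)) (lemma₂ (2 ^ (2 * H + 6)) κ)

large : ∀ H r n → 2 ^ (2 * H + 17) ≤ r → r < 2 ^ (2 * H + 19) → 2 ^ (4 * H + 13) ≤ n → FBound (2^64 * 2 ^ 17) r n
large H r n r≥ r< n≥ = colouring , λ ℓ τ → begin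
    ℓ * r                                      ≤⟨ *-mono-≤ (twin-bound′ ℓ τ) (<⇒≤ r<) ⟩
    2^64 * (12 * N) * 2 ^ (2 * H + 19)         ≡⟨ cong (2^64 * (12 * N) *_) (trans (cong (2 ^_) (lemma₁ H)) (^-distribˡ-+-* 2 12 D)) ⟩
    2^64 * (12 * N) * (2 ^ 12 * 2 ^ D)         ≡⟨ lemma₂ 2^64 N (2 ^ 12) (2 ^ D) ⟩
    2^64 * (12 * 2 ^ 12) * (N * 2 ^ D)         ≤⟨ *-monoʳ-≤ (2^64 * (12 * 2 ^ 12)) N2^D≤2n ⟩
    2^64 * (12 * 2 ^ 12) * (2 * n)             ≡⟨ lemma₃ 2^64 (12 * 2 ^ 12) n ⟩
    -- `24 * 2 ^ 12 + 2 ^ 15 = 2 ^ 17`.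
    2^64 * (2 * (12 * 2 ^ 12)) * n             ≤⟨ *-monoˡ-≤ n (*-monoʳ-≤ 2^64 (m≤m+n (2 * (12 * 2 ^ 12)) 32768)) ⟩
    2^64 * 2 ^ 17 * n                          ∎
  where
  open ≤-Reasoning
  P = 2 ^ (4 * H + 13)
  instance
    P≢0 : NonZero P
    P≢0 = m^n≢0 2 (4 * H + 13)
    r≢0 : NonZero r
    r≢0 = >-nonZero (<-≤-trans (m^n>0 2 (2 * H + 17)) r≥)
  -- `κ * P` is the next multiple of `P` beyond `n`; as `P ≤ n`, it is at most `2 * n`.
  κ = suc (n / P)
  lemma₀ : ∀ H → 2 * H + 6 + (2 * H + 7) ≡ 4 * H + 13
  lemma₀ = solve-∀
  lemma₀′ : ∀ a κ b → a * κ * b ≡ κ * (a * b)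
  lemma₀′ = solve-∀
  lemma₁ : ∀ H → 2 * H + 19 ≡ 12 + (2 * H + 7)
  lemma₁ = solve-∀
  lemma₂ : ∀ T N A B → T * (12 * N) * (A * B) ≡ T * (12 * A) * (N * B)
  lemma₂ = solve-∀
  lemma₃ : ∀ T A n → T * A * (2 * n) ≡ T * (2 * A) * n
  lemma₃ = solve-∀
  vertices : 2 ^ (2 * H + 6) * κ * 2 ^ (2 * H + 7) ≡ κ * P
  vertices = trans (lemma₀′ (2 ^ (2 * H + 6)) κ (2 ^ (2 * H + 7))) (cong (κ *_)
    (trans (sym (^-distribˡ-+-* 2 (2 * H + 6) (2 * H + 7))) (cong (2 ^_) (lemma₀ H))))
  n≤κP : n ≤ κ * P
  n≤κP = ≤-trans (≤-reflexive (m≡m%n+[m/n]*n n P)) (+-monoˡ-≤ (n / P * P) (<⇒≤ (m%n<n n P)))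
  open Large H κ n r r≥ (≤-trans n≤κP (≤-reflexive (sym vertices)))
  N2^D≤2n : N * 2 ^ D ≤ 2 * n
  N2^D≤2n = begin
    N * 2 ^ D          ≡⟨ vertices ⟩
    P + n / P * P      ≤⟨ +-mono-≤ n≥ (≤-trans (m≤n+m _ (n % P)) (≤-reflexive (sym (m≡m%n+[m/n]*n n P)))) ⟩
    n + n              ≡⟨ cong (n +_) (sym (+-identityʳ n)) ⟩
    2 * n              ∎

-- For bounded `r` the trivial bound `ℓ ≤ n` is enough, with `r` absorbed by the constant.
small : ∀ r n → 1 ≤ r → r ≤ 2 ^ 17 → FBound (2^64 * 2 ^ 17) r n
small r n 1≤r r≤ = (λ _ _ → clamp r {{>-nonZero 1≤r}} 0) , λ ℓ τ → begin
  ℓ * r                  ≤⟨ *-mono-≤ (twin-size-≤ τ) r≤ ⟩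
  n * 2 ^ 17             ≡⟨ *-comm n (2 ^ 17) ⟩
  2 ^ 17 * n             ≤⟨ *-monoˡ-≤ n (m≤n*m (2 ^ 17) 2^64 {{>-nonZero 2^64>0}}) ⟩
  2^64 * 2 ^ 17 * n      ∎
  where open ≤-Reasoning

theorem3 : Σ ℕ λ C → (0 < C) × ((r : ℕ) → 1 ≤ r → Σ ℕ λ N → (n : ℕ) → N ≤ n → FBound C r n)
theorem3 = 2^64 * 2 ^ 17 , *-mono-≤ 2^64>0 (m^n>0 2 17) , bound
  where
  bound : (r : ℕ) → 1 ≤ r → Σ ℕ λ N → (n : ℕ) → N ≤ n → FBound (2^64 * 2 ^ 17) r n
  bound r 1≤r with scale r
  ... | inj₁ r<             = 0 , λ n _ → small r n 1≤r (<⇒≤ r<)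
  ... | inj₂ (H , r≥ , r<) = 2 ^ (4 * H + 13) , λ n → large H r n r≥ r<
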